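{- Let $b\ge 2$ be an integer and let $w=d_1\dots d_p$ be a fixed block of $b$-ary digits of length $p\ge 1$. For each integer $k\ge 0$ let $$S_w(k)=\sum_{m}\frac1m,$$ where the sum runs over all positive integers $m$ whose minimal base-$b$ representation (the string of $b$-ary digits without leading zeros) contains exactly $k$ occurrences of $w$, counting possibly overlapping occurrences. Then for every integer $k\ge 1$, $$\Bigl|S_w(k)-b^{p}\log(b)\Bigr|\le (b-1)\,b^{\,p-\max(k,2)+1}.$$
   Context: An occurrence of $w$ in a string $X=x_1\dots x_l$ is an index $i$ with $1\le i\le l-p+1$ and $x_i x_{i+1}\dots x_{i+p-1}=w$. Different occurrences may overlap. -}

module Defs where

open import Data.Bool.Base using (if_then_else_)
open import Data.Digit using (toDigits)
open import Data.Fin.Base using (Fin; toℕ)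
import Data.Fin.Properties as Fin
open import Data.Integer.Base as ℤ using (ℤ; +_; -[1+_]; +[1+_])
import Data.Integer.Properties as ℤ
open import Data.List.Base using (List; length; filter; upTo; take; drop; dropWhile; reverse)
import Data.List.Properties as List
open import Data.Nat.Base as ℕ using (ℕ; zero; suc)
import Data.Nat.Properties as ℕ
open import Data.Product.Base using (∃-syntax; _×_; _,_; proj₁)
open import Data.Rational.Base
open import Data.Rational.Properties
open import Data.Rational.Solver using (module +-*-Solver)
import Data.Rational.Unnormalised.Base as ℚᵘ
import Data.Rational.Unnormalised.Properties as ℚᵘ
open import Data.Sum.Base using (inj₁; inj₂)
open import Data.Vec.Base using (Vec; toList)
open import Relation.Binary.PropositionalEquality
open import Relation.Nullary.Decidable using (yes; no; does; fromWitness)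
open import Relation.Nullary.Negation using (contradiction)

open import Algebra.Definitions.RawSemiring +-*-rawSemiring public using (_^_)

fromℕ : ℕ → ℚ
fromℕ n = + n / 1

-- Total reciprocal, with recip 0 = 0.
recip : ℚ → ℚ
recip q with q ≟ 0ℚ
... | yes _  = 0ℚ
... | no q≢0 = (1/ q) {{≢-nonZero q≢0}}

-- For a nonzero base this is the usual power; negative powers of 0 are 0.
infixr 8 _^ℤ_
_^ℤ_ : ℚ → ℤ → ℚ
q ^ℤ (+ n)    = q ^ n
q ^ℤ -[1+ n ] = recip (q ^ suc n)

∑< : ℕ → (ℕ → ℚ) → ℚ
∑< zero    f = 0ℚ
∑< (suc n) f = ∑< n f + f n

private
  toℚᵘ-fromℕ : ∀ n → toℚᵘ (fromℕ n) ℚᵘ.≃ ℚᵘ.mkℚᵘ (+ n) 0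
  toℚᵘ-fromℕ n = toℚᵘ-fromℚᵘ (ℚᵘ.mkℚᵘ (+ n) 0)

fromℕ-+ : ∀ m n → fromℕ (m ℕ.+ n) ≡ fromℕ m + fromℕ n
fromℕ-+ m n = toℚᵘ-injective (begin
  toℚᵘ (fromℕ (m ℕ.+ n))                   ≈⟨ toℚᵘ-fromℕ (m ℕ.+ n) ⟩
  ℚᵘ.mkℚᵘ (+ (m ℕ.+ n)) 0                  ≈⟨ ℚᵘ.*≡* (cong (ℤ._* (+ 1)) (sym (cong₂ ℤ._+_ (ℤ.*-identityʳ (+ m)) (ℤ.*-identityʳ (+ n))))) ⟩
  ℚᵘ.mkℚᵘ (+ m) 0 ℚᵘ.+ ℚᵘ.mkℚᵘ (+ n) 0     ≈⟨ ℚᵘ.+-cong (toℚᵘ-fromℕ m) (toℚᵘ-fromℕ n) ⟨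
  toℚᵘ (fromℕ m) ℚᵘ.+ toℚᵘ (fromℕ n)       ≈⟨ toℚᵘ-homo-+ (fromℕ m) (fromℕ n) ⟨
  toℚᵘ (fromℕ m + fromℕ n)                 ∎)
  where open import Relation.Binary.Reasoning.Setoid ℚᵘ.≃-setoid

fromℕ-* : ∀ m n → fromℕ (m ℕ.* n) ≡ fromℕ m * fromℕ n
fromℕ-* m n = toℚᵘ-injective (begin
  toℚᵘ (fromℕ (m ℕ.* n))                   ≈⟨ toℚᵘ-fromℕ (m ℕ.* n) ⟩
  ℚᵘ.mkℚᵘ (+ (m ℕ.* n)) 0                  ≈⟨ ℚᵘ.*≡* (cong (ℤ._* (+ 1)) (ℤ.pos-* m n)) ⟩
  ℚᵘ.mkℚᵘ (+ m) 0 ℚᵘ.* ℚᵘ.mkℚᵘ (+ n) 0     ≈⟨ ℚᵘ.*-cong (toℚᵘ-fromℕ m) (toℚᵘ-fromℕ n) ⟨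
  toℚᵘ (fromℕ m) ℚᵘ.* toℚᵘ (fromℕ n)       ≈⟨ toℚᵘ-homo-* (fromℕ m) (fromℕ n) ⟨
  toℚᵘ (fromℕ m * fromℕ n)                 ∎)
  where open import Relation.Binary.Reasoning.Setoid ℚᵘ.≃-setoid

fromℕ-mono-≤ : ∀ {m n} → m ℕ.≤ n → fromℕ m ≤ fromℕ n
fromℕ-mono-≤ {m} {n} m≤n = toℚᵘ-cancel-≤ (begin
  toℚᵘ (fromℕ m)      ≃⟨ toℚᵘ-fromℕ m ⟩
  ℚᵘ.mkℚᵘ (+ m) 0     ≤⟨ ℚᵘ.*≤* (ℤ.*-monoʳ-≤-nonNeg (+ 1) (ℤ.+≤+ m≤n)) ⟩
  ℚᵘ.mkℚᵘ (+ n) 0     ≃⟨ toℚᵘ-fromℕ n ⟨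
  toℚᵘ (fromℕ n)      ∎)
  where open ℚᵘ.≤-Reasoning

1≤fromℕ : ∀ {n} → 2 ℕ.≤ n → 1ℚ ≤ fromℕ n
1≤fromℕ 2≤n = fromℕ-mono-≤ (ℕ.≤-trans (ℕ.n≤1+n 1) 2≤n)

0≤fromℕ : ∀ n → 0ℚ ≤ fromℕ n
0≤fromℕ n = fromℕ-mono-≤ {0} {n} ℕ.z≤n

private
  open +-*-Solver using (solve; _:+_; _:*_; _:-_; :-_; _:=_; con)

  0<fromℕ-suc : ∀ n → 0ℚ < fromℕ (suc n)
  0<fromℕ-suc n = <-≤-trans (positive⁻¹ 1ℚ) (fromℕ-mono-≤ {1} {suc n} (ℕ.s≤s ℕ.z≤n))

  *-monoˡ : ∀ {r p q} → 0ℚ ≤ r → p ≤ q → r * p ≤ r * q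
  *-monoˡ {r} 0≤r = *-monoˡ-≤-nonNeg r {{nonNegative 0≤r}}

  *-monoʳ : ∀ {r p q} → 0ℚ ≤ r → p ≤ q → p * r ≤ q * r
  *-monoʳ {r} 0≤r = *-monoʳ-≤-nonNeg r {{nonNegative 0≤r}}

  *-nonNeg : ∀ {p q} → 0ℚ ≤ p → 0ℚ ≤ q → 0ℚ ≤ p * q
  *-nonNeg {p} {q} 0≤p 0≤q = subst (_≤ p * q) (*-zeroʳ p) (*-monoˡ 0≤p 0≤q)

  p≤q⇒0≤q-p : ∀ {p q} → p ≤ q → 0ℚ ≤ q - p
  p≤q⇒0≤q-p {p} {q} p≤q = subst (_≤ q - p) (+-inverseʳ p) (+-monoˡ-≤ (- p) p≤q)

  p≤q+r⇒p-q≤r : ∀ {p q r} → p ≤ q + r → p - q ≤ r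
  p≤q+r⇒p-q≤r {p} {q} {r} p≤q+r = subst (p - q ≤_)
    (solve 2 (λ q r → q :+ r :- q := r) refl q r) (+-monoˡ-≤ (- q) p≤q+r)

  recip-inverse : ∀ {q} → 0ℚ < q → q * recip q ≡ 1ℚ
  recip-inverse {q} 0<q with q ≟ 0ℚ
  ... | yes q≡0 = contradiction (sym q≡0) (<⇒≢ 0<q)
  ... | no q≢0  = *-inverseʳ q {{≢-nonZero q≢0}}

  0≤recip : ∀ {q} → 0ℚ < q → 0ℚ ≤ recip q
  0≤recip {q} 0<q with q ≟ 0ℚ
  ... | yes _  = ≤-refl
  ... | no q≢0 = <⇒≤ (positive⁻¹ _ {{1/pos⇒pos q {{positive 0<q}}}})

  recip-antimono : ∀ {p q} → 0ℚ < p → p ≤ q → recip q ≤ recip p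
  recip-antimono {p} {q} 0<p p≤q = begin
    recip q                   ≡⟨ *-identityʳ (recip q) ⟨
    recip q * 1ℚ              ≡⟨ cong (recip q *_) (recip-inverse 0<p) ⟨
    recip q * (p * recip p)   ≤⟨ *-monoˡ (0≤recip 0<q) (*-monoʳ (0≤recip 0<p) p≤q) ⟩
    recip q * (q * recip p)   ≡⟨ solve 3 (λ a b c → a :* (b :* c) := b :* a :* c) refl (recip q) q (recip p) ⟩
    q * recip q * recip p     ≡⟨ cong (_* recip p) (recip-inverse 0<q) ⟩
    1ℚ * recip p              ≡⟨ *-identityˡ (recip p) ⟩
    recip p                   ∎
    where
    open ≤-Reasoning
    0<q = <-≤-trans 0<p p≤q

  ∣∣≤ : ∀ {p ε} → p ≤ ε → - p ≤ ε → ∣ p ∣ ≤ ε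
  ∣∣≤ {p} p≤ε -p≤ε with ∣p∣≡p∨∣p∣≡-p p
  ... | inj₁ eq = subst (_≤ _) (sym eq) p≤ε
  ... | inj₂ eq = subst (_≤ _) (sym eq) -p≤ε

  ≤fromℕ : ∀ p → p ≤ fromℕ ℤ.∣ ↥ p ∣
  ≤fromℕ p@(mkℚ n d _) = toℚᵘ-cancel-≤ (begin
    ℚᵘ.mkℚᵘ n d              ≤⟨ ℚᵘ.*≤* (bound n) ⟩
    ℚᵘ.mkℚᵘ (+ ℤ.∣ n ∣) 0    ≃⟨ toℚᵘ-fromℕ ℤ.∣ n ∣ ⟨
    toℚᵘ (fromℕ ℤ.∣ n ∣)     ∎)
    where
    open ℚᵘ.≤-Reasoning
    bound : ∀ n → n ℤ.* + 1 ℤ.≤ (+ ℤ.∣ n ∣) ℤ.* + suc d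
    bound (+ n)    = subst₂ ℤ._≤_ (ℤ.pos-* n 1) (ℤ.pos-* n (suc d))
                       (ℤ.+≤+ (ℕ.*-monoʳ-≤ n (ℕ.s≤s ℕ.z≤n)))
    bound -[1+ n ] = ℤ.-≤+

  ∃-recip≤ : ∀ x ε → 0ℚ < ε → ∃[ K ] (∀ n → K ℕ.≤ n → x * recip (fromℕ (suc n)) ≤ ε)
  ∃-recip≤ x ε 0<ε = K , λ n K≤n → begin
    x * recip (fromℕ (suc n))                         ≤⟨ *-monoʳ (0≤recip (0<fromℕ-suc n)) (x≤ n K≤n) ⟩
    ε * fromℕ (suc n) * recip (fromℕ (suc n))         ≡⟨ *-assoc ε _ _ ⟩
    ε * (fromℕ (suc n) * recip (fromℕ (suc n)))       ≡⟨ cong (ε *_) (recip-inverse (0<fromℕ-suc n)) ⟩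
    ε * 1ℚ                                            ≡⟨ *-identityʳ ε ⟩
    ε                                                 ∎
    where
    open ≤-Reasoning
    r = x * recip ε
    K = ℤ.∣ ↥ r ∣
    x≤ : ∀ n → K ℕ.≤ n → x ≤ ε * fromℕ (suc n)
    x≤ n K≤n = begin
      x                   ≡⟨ *-identityˡ x ⟨
      1ℚ * x              ≡⟨ cong (_* x) (recip-inverse 0<ε) ⟨
      ε * recip ε * x     ≡⟨ solve 3 (λ a b c → a :* b :* c := a :* (c :* b)) refl ε (recip ε) x ⟩
      ε * r               ≤⟨ *-monoˡ (<⇒≤ 0<ε) (≤-trans (≤fromℕ r) (fromℕ-mono-≤ (ℕ.≤-trans K≤n (ℕ.n≤1+n n)))) ⟩
      ε * fromℕ (suc n)   ∎

Cauchy : (ℕ → ℚ) → Set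
Cauchy x = ∀ ε → 0ℚ < ε →
  ∃[ N ] (∀ m n → N ℕ.≤ m → N ℕ.≤ n → ∣ x m - x n ∣ ≤ ε)

-- Equality of reals is x ≤ᴿ y and y ≤ᴿ x, not _≡_.
record ℝ : Set where
  constructor mkℝ
  field
    seq    : ℕ → ℚ
    cauchy : Cauchy seq

open ℝ public

infix 4 _≤ᴿ_
_≤ᴿ_ : ℝ → ℝ → Set
x ≤ᴿ y = ∀ ε → 0ℚ < ε →
  ∃[ N ] (∀ n → N ℕ.≤ n → seq x n ≤ seq y n + ε)

fromℚ : ℚ → ℝ
fromℚ q = mkℝ (λ _ → q) λ ε 0<ε →
  0 , λ _ _ _ _ → subst (λ z → ∣ z ∣ ≤ ε) (sym (+-inverseʳ q)) (<⇒≤ 0<ε)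

infixl 6 _-ᴿ_
_-ᴿ_ : ℝ → ℝ → ℝ
x -ᴿ y = mkℝ (λ n → seq x n - seq y n) λ ε 0<ε →
  let 0<½ε = subst (_< ½ * ε) (*-zeroʳ ½) (*-monoʳ-<-pos ½ 0<ε)
      M , p = cauchy x (½ * ε) 0<½ε
      N , q = cauchy y (½ * ε) 0<½ε
  in M ℕ.⊔ N , λ m n M⊔N≤m M⊔N≤n → begin
    ∣ (seq x m - seq y m) - (seq x n - seq y n) ∣
      ≡⟨ cong ∣_∣ (solve 4 (λ a b c d → (a :- b) :- (c :- d) := (a :- c) :- (b :- d)) refl (seq x m) (seq y m) (seq x n) (seq y n)) ⟩
    ∣ (seq x m - seq x n) - (seq y m - seq y n) ∣
      ≤⟨ ∣p-q∣≤∣p∣+∣q∣ (seq x m - seq x n) (seq y m - seq y n) ⟩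
    ∣ seq x m - seq x n ∣ + ∣ seq y m - seq y n ∣
      ≤⟨ +-mono-≤ (p m n (ℕ.m⊔n≤o⇒m≤o M N M⊔N≤m) (ℕ.m⊔n≤o⇒m≤o M N M⊔N≤n))
                  (q m n (ℕ.m⊔n≤o⇒n≤o M N M⊔N≤m) (ℕ.m⊔n≤o⇒n≤o M N M⊔N≤n)) ⟩
    ½ * ε + ½ * ε
      ≡⟨ solve 1 (λ e → con ½ :* e :+ con ½ :* e := e) refl ε ⟩
    ε ∎
  where open ≤-Reasoning

infixr 7 _·_
_·_ : ℚ → ℝ → ℝ
q · x = mkℝ (λ n → q * seq x n) λ ε 0<ε →
  let s     = 1ℚ + ∣ q ∣
      0<s   = <-≤-trans (positive⁻¹ 1ℚ) (subst (_≤ s) (+-identityʳ 1ℚ) (+-monoʳ-≤ 1ℚ (0≤∣p∣ q)))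
      0<1/s = ≤∧≢⇒< (0≤recip 0<s) (λ 0≡1/s → <⇒≢ (positive⁻¹ 1ℚ)
                (trans (sym (*-zeroʳ s)) (trans (cong (s *_) 0≡1/s) (recip-inverse 0<s))))
      δ     = ε * recip s
      0<δ   = subst (_< δ) (*-zeroʳ ε) (*-monoʳ-<-pos ε {{positive 0<ε}} 0<1/s)
      N , p = cauchy x δ 0<δ
  in N , λ m n N≤m N≤n → begin
    ∣ q * seq x m - q * seq x n ∣
      ≡⟨ cong ∣_∣ (solve 3 (λ a b c → a :* b :- a :* c := a :* (b :- c)) refl q (seq x m) (seq x n)) ⟩
    ∣ q * (seq x m - seq x n) ∣
      ≡⟨ ∣p*q∣≡∣p∣*∣q∣ q (seq x m - seq x n) ⟩
    ∣ q ∣ * ∣ seq x m - seq x n ∣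
      ≤⟨ *-monoˡ (0≤∣p∣ q) (p m n N≤m N≤n) ⟩
    ∣ q ∣ * δ
      ≤⟨ *-monoʳ (<⇒≤ 0<δ) (subst (_≤ s) (+-identityˡ ∣ q ∣) (+-monoˡ-≤ ∣ q ∣ (<⇒≤ (positive⁻¹ 1ℚ)))) ⟩
    s * δ
      ≡⟨ solve 3 (λ a b c → a :* (b :* c) := b :* (a :* c)) refl s ε (recip s) ⟩
    ε * (s * recip s)
      ≡⟨ cong (ε *_) (recip-inverse 0<s) ⟩
    ε * 1ℚ
      ≡⟨ *-identityʳ ε ⟩
    ε ∎
  where
  open ≤-Reasoning
  ≤∧≢⇒< : ∀ {p q} → p ≤ q → p ≢ q → p < q
  ≤∧≢⇒< {p} {q} p≤q p≢q = ≰⇒> λ q≤p → p≢q (≤-antisym p≤q q≤p)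

∣_∣ᴿ : ℝ → ℝ
∣ x ∣ᴿ = mkℝ (λ n → ∣ seq x n ∣) λ ε 0<ε →
  let N , p = cauchy x ε 0<ε
  in N , λ m n N≤m N≤n → ∣∣≤
       (≤-trans (reverse-triangle (seq x m) (seq x n)) (p m n N≤m N≤n))
       (≤-trans (≤-reflexive (solve 2 (λ a b → :- (a :- b) := b :- a) refl ∣ seq x m ∣ ∣ seq x n ∣))
         (≤-trans (reverse-triangle (seq x n) (seq x m)) (p n m N≤n N≤m)))
  where
  reverse-triangle : ∀ a b → ∣ a ∣ - ∣ b ∣ ≤ ∣ a - b ∣
  reverse-triangle a b = p≤q+r⇒p-q≤r (subst (λ z → ∣ z ∣ ≤ ∣ b ∣ + ∣ a - b ∣)
    (solve 2 (λ a b → b :+ (a :- b) := a) refl a b) (∣p+q∣≤∣p∣+∣q∣ b (a - b)))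

HasSum : (ℕ → ℚ) → ℝ → Set
HasSum f S = ∀ ε → 0ℚ < ε →
  ∃[ N ] (∀ n → N ℕ.≤ n → ∣ fromℚ (∑< n f) -ᴿ S ∣ᴿ ≤ᴿ fromℚ ε)

-- Right-endpoint Riemann sum of f on [ a , c ], suc n equal intervals.
riemannSum : (ℚ → ℚ) → (a c : ℚ) → ℕ → ℚ
riemannSum f a c n = ∑< (suc n) λ i → f (a + fromℕ (suc i) * h) * h
  where h = (c - a) * recip (fromℕ (suc n))

AntitoneFrom : ℚ → (ℚ → ℚ) → Set
AntitoneFrom a f = ∀ {s t} → a ≤ s → s ≤ t → f t ≤ f s

private
  ∑-mono : ∀ n {f g} → (∀ i → f i ≤ g i) → ∑< n f ≤ ∑< n g
  ∑-mono zero    f≤g = ≤-refl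
  ∑-mono (suc n) f≤g = +-mono-≤ (∑-mono n f≤g) (f≤g n)

  ∑-split : ∀ m n f → ∑< (n ℕ.+ m) f ≡ ∑< m f + ∑< n (λ i → f (i ℕ.+ m))
  ∑-split m zero    f = sym (+-identityʳ _)
  ∑-split m (suc n) f = trans (cong (_+ f (n ℕ.+ m)) (∑-split m n f))
    (+-assoc (∑< m f) (∑< n (λ i → f (i ℕ.+ m))) (f (n ℕ.+ m)))

  fromℕ-suc-* : ∀ n c → fromℕ n * c + c ≡ fromℕ (suc n) * c
  fromℕ-suc-* n c = trans
    (solve 2 (λ x c → x :* c :+ c := (con 1ℚ :+ x) :* c) refl (fromℕ n) c)
    (cong (_* c) (sym (fromℕ-+ 1 n)))

  ∑≥ : ∀ n {f c} → (∀ i → i ℕ.< n → c ≤ f i) → fromℕ n * c ≤ ∑< n f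
  ∑≥ zero    {c = c} _   = ≤-reflexive (*-zeroˡ c)
  ∑≥ (suc n) {f} {c} c≤f = subst (_≤ ∑< n f + f n) (fromℕ-suc-* n c)
    (+-mono-≤ (∑≥ n (λ i i<n → c≤f i (ℕ.m<n⇒m<1+n i<n))) (c≤f n ℕ.≤-refl))

  ∑≤ : ∀ n {f c} → (∀ i → i ℕ.< n → f i ≤ c) → ∑< n f ≤ fromℕ n * c
  ∑≤ zero    {c = c} _   = ≤-reflexive (sym (*-zeroˡ c))
  ∑≤ (suc n) {f} {c} f≤c = subst (∑< n f + f n ≤_) (fromℕ-suc-* n c)
    (+-mono-≤ (∑≤ n (λ i i<n → f≤c i (ℕ.m<n⇒m<1+n i<n))) (f≤c n ℕ.≤-refl))

  ∑-block-≥ : ∀ N m (A B : ℕ → ℚ) → (∀ i r → r ℕ.< m → A i ≤ B (r ℕ.+ i ℕ.* m)) →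
              ∑< N (λ i → fromℕ m * A i) ≤ ∑< (N ℕ.* m) B
  ∑-block-≥ zero    m A B _   = ≤-refl
  ∑-block-≥ (suc N) m A B A≤B = subst (_ ≤_) (sym (∑-split (N ℕ.* m) m B))
    (+-mono-≤ (∑-block-≥ N m A B A≤B) (∑≥ m {c = A N} (A≤B N)))

  ∑-block-≤ : ∀ N m (A B : ℕ → ℚ) → (∀ i r → r ℕ.< m → B (r ℕ.+ i ℕ.* m) ≤ A i) →
              ∑< (N ℕ.* m) B ≤ ∑< N (λ i → fromℕ m * A i)
  ∑-block-≤ zero    m A B _   = ≤-refl
  ∑-block-≤ (suc N) m A B B≤A = subst (_≤ _) (sym (∑-split (N ℕ.* m) m B))
    (+-mono-≤ (∑-block-≤ N m A B B≤A) (∑≤ m {c = A N} (B≤A N)))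

  ∑-cong : ∀ n {f g} → (∀ i → f i ≡ g i) → ∑< n f ≡ ∑< n g
  ∑-cong zero    f≡g = refl
  ∑-cong (suc n) f≡g = cong₂ _+_ (∑-cong n f≡g) (f≡g n)

module _ {f : ℚ → ℚ} {a c : ℚ} (a≤c : a ≤ c) (f↓ : AntitoneFrom a f) where

  private
    lower upper : ℚ → ℕ → ℚ
    lower h N = ∑< N λ i → f (a + fromℕ (suc i) * h) * h
    upper h N = ∑< N λ i → f (a + fromℕ i * h) * h

    a≤a+ : ∀ {x} → 0ℚ ≤ x → a ≤ a + x
    a≤a+ {x} 0≤x = subst (_≤ a + x) (+-identityʳ a) (+-monoʳ-≤ a 0≤x)

    step-antitone : ∀ h → 0ℚ ≤ h → ∀ {i j} → i ℕ.≤ j → f (a + fromℕ j * h) * h ≤ f (a + fromℕ i * h) * h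
    step-antitone h 0≤h {i} i≤j = *-monoʳ 0≤h (f↓ (a≤a+ (*-nonNeg (0≤fromℕ i) 0≤h))
      (+-monoʳ-≤ a (*-monoʳ 0≤h (fromℕ-mono-≤ i≤j))))

    coarse : ∀ h m i → f (a + fromℕ i * (fromℕ m * h)) * (fromℕ m * h)
                       ≡ fromℕ m * (f (a + fromℕ (i ℕ.* m) * h) * h)
    coarse h m i = begin
      f (a + fromℕ i * (fromℕ m * h)) * (fromℕ m * h)
        ≡⟨ cong (λ x → f (a + x) * (fromℕ m * h)) (sym (*-assoc (fromℕ i) (fromℕ m) h)) ⟩
      f (a + fromℕ i * fromℕ m * h) * (fromℕ m * h)
        ≡⟨ cong (λ x → f (a + x * h) * (fromℕ m * h)) (sym (fromℕ-* i m)) ⟩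
      f (a + fromℕ (i ℕ.* m) * h) * (fromℕ m * h)
        ≡⟨ solve 3 (λ x y z → x :* (y :* z) := y :* (x :* z)) refl (f (a + fromℕ (i ℕ.* m) * h)) (fromℕ m) h ⟩
      fromℕ m * (f (a + fromℕ (i ℕ.* m) * h) * h) ∎
      where open ≡-Reasoning

    lower-refine : ∀ h → 0ℚ ≤ h → ∀ N m → lower (fromℕ m * h) N ≤ lower h (N ℕ.* m)
    lower-refine h 0≤h N m = subst (_≤ lower h (N ℕ.* m))
      (∑-cong N (λ i → sym (coarse h m (suc i))))
      (∑-block-≥ N m (λ i → f (a + fromℕ (suc i ℕ.* m) * h) * h)
        (λ i → f (a + fromℕ (suc i) * h) * h) λ i r r<m → step-antitone h 0≤h (ℕ.+-monoˡ-≤ (i ℕ.* m) r<m))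

    upper-refine : ∀ h → 0ℚ ≤ h → ∀ N m → upper h (N ℕ.* m) ≤ upper (fromℕ m * h) N
    upper-refine h 0≤h N m = subst (upper h (N ℕ.* m) ≤_)
      (∑-cong N (λ i → sym (coarse h m i)))
      (∑-block-≤ N m (λ i → f (a + fromℕ (i ℕ.* m) * h) * h)
        (λ i → f (a + fromℕ i * h) * h) λ i r r<m → step-antitone h 0≤h (ℕ.m≤n+m (i ℕ.* m) r))

    lower≤upper : ∀ h → 0ℚ ≤ h → ∀ N → lower h N ≤ upper h N
    lower≤upper h 0≤h N = ∑-mono N λ i → step-antitone h 0≤h (ℕ.n≤1+n i)

    upper-telescope : ∀ h N → upper h N ≡ lower h N + (f (a + fromℕ 0 * h) * h - f (a + fromℕ N * h) * h)
    upper-telescope h zero    = sym (trans (+-identityˡ _) (+-inverseʳ (f (a + fromℕ 0 * h) * h)))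
    upper-telescope h (suc N) = trans (cong (_+ f (a + fromℕ N * h) * h) (upper-telescope h N))
      (solve 4 (λ l x y z → l :+ (x :- y) :+ y := l :+ z :+ (x :- z)) refl
        (lower h N) (f (a + fromℕ 0 * h) * h) (f (a + fromℕ N * h) * h) (f (a + fromℕ (suc N) * h) * h))

    mesh : ℕ → ℚ
    mesh n = (c - a) * recip (fromℕ (suc n))

    0≤mesh : ∀ n → 0ℚ ≤ mesh n
    0≤mesh n = *-nonNeg (p≤q⇒0≤q-p a≤c) (0≤recip (0<fromℕ-suc n))

    suc*mesh : ∀ n → fromℕ (suc n) * mesh n ≡ c - a
    suc*mesh n = begin
      fromℕ (suc n) * ((c - a) * recip (fromℕ (suc n)))
        ≡⟨ solve 3 (λ x y z → x :* (y :* z) := y :* (x :* z)) refl (fromℕ (suc n)) (c - a) (recip (fromℕ (suc n))) ⟩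
      (c - a) * (fromℕ (suc n) * recip (fromℕ (suc n)))
        ≡⟨ cong ((c - a) *_) (recip-inverse (0<fromℕ-suc n)) ⟩
      (c - a) * 1ℚ
        ≡⟨ *-identityʳ (c - a) ⟩
      c - a ∎
      where open ≡-Reasoning

    endpoint : ∀ n → a + fromℕ (suc n) * mesh n ≡ c
    endpoint n = trans (cong (_+_ a) (suc*mesh n)) (solve 2 (λ a c → a :+ (c :- a) := c) refl a c)

    lower≤upper′ : ∀ m n → lower (mesh m) (suc m) ≤ upper (mesh n) (suc n)
    lower≤upper′ m n = begin
      lower (mesh m) M            ≡⟨ cong (λ x → lower x M) mesh-m ⟩
      lower (fromℕ N * h) M       ≤⟨ lower-refine h 0≤h M N ⟩
      lower h (M ℕ.* N)           ≤⟨ lower≤upper h 0≤h (M ℕ.* N) ⟩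
      upper h (M ℕ.* N)           ≡⟨ cong (upper h) (ℕ.*-comm M N) ⟩
      upper h (N ℕ.* M)           ≤⟨ upper-refine h 0≤h N M ⟩
      upper (fromℕ M * h) N       ≡⟨ cong (λ x → upper x N) mesh-n ⟨
      upper (mesh n) N            ∎
      where
      open ≤-Reasoning
      M = suc m
      N = suc n
      rM = recip (fromℕ M)
      rN = recip (fromℕ N)
      h = (c - a) * rM * rN
      0≤h : 0ℚ ≤ h
      0≤h = *-nonNeg (0≤mesh m) (0≤recip (0<fromℕ-suc n))
      mesh-m : mesh m ≡ fromℕ N * h
      mesh-m = trans (sym (*-identityʳ _)) (trans (cong (mesh m *_) (sym (recip-inverse (0<fromℕ-suc n))))
        (solve 3 (λ x y z → x :* (y :* z) := y :* (x :* z)) refl (mesh m) (fromℕ N) rN))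
      mesh-n : mesh n ≡ fromℕ M * h
      mesh-n = trans (sym (*-identityʳ _)) (trans (cong (mesh n *_) (sym (recip-inverse (0<fromℕ-suc m))))
        (solve 4 (λ d x y z → d :* x :* (y :* z) := y :* (d :* z :* x)) refl (c - a) rN (fromℕ M) rM))

    gap : ℚ
    gap = (c - a) * (f a - f c)

    lower-close : ∀ m n → riemannSum f a c m - riemannSum f a c n ≤ gap * recip (fromℕ (suc n))
    lower-close m n = p≤q+r⇒p-q≤r (subst (lower (mesh m) (suc m) ≤_) eq (lower≤upper′ m n))
      where
      open ≡-Reasoning
      eq : upper (mesh n) (suc n) ≡ lower (mesh n) (suc n) + gap * recip (fromℕ (suc n))
      eq = begin
        upper (mesh n) (suc n)
          ≡⟨ upper-telescope (mesh n) (suc n) ⟩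
        lower (mesh n) (suc n) + (f (a + 0ℚ * mesh n) * mesh n - f (a + fromℕ (suc n) * mesh n) * mesh n)
          ≡⟨ cong₂ (λ x y → lower (mesh n) (suc n) + (f x * mesh n - f y * mesh n))
               (trans (cong (_+_ a) (*-zeroˡ (mesh n))) (+-identityʳ a)) (endpoint n) ⟩
        lower (mesh n) (suc n) + (f a * mesh n - f c * mesh n)
          ≡⟨ cong (_+_ (lower (mesh n) (suc n)))
               (solve 4 (λ x y d r → x :* (d :* r) :- y :* (d :* r) := d :* (x :- y) :* r) refl
                 (f a) (f c) (c - a) (recip (fromℕ (suc n)))) ⟩
        lower (mesh n) (suc n) + gap * recip (fromℕ (suc n)) ∎

  -- ∫ f over [ a , c ]: a monotone f is Riemann integrable, so the limit along
  -- uniform partitions is the integral.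
  integral : ℝ
  integral = mkℝ (riemannSum f a c) λ ε 0<ε →
    let K , small = ∃-recip≤ gap ε 0<ε
    in K , λ m n K≤m K≤n → ∣∣≤
         (≤-trans (lower-close m n) (small n K≤n))
         (≤-trans (≤-reflexive (solve 2 (λ x y → :- (x :- y) := y :- x) refl (riemannSum f a c m) (riemannSum f a c n)))
           (≤-trans (lower-close n m) (small m K≤m)))

-- log x = ∫ dt/t over [ 1 , x ]; recip is the true reciprocal there.
log : (x : ℚ) → 1ℚ ≤ x → ℝ
log x 1≤x = integral {recip} 1≤x λ 1≤s → recip-antimono (<-≤-trans (positive⁻¹ 1ℚ) 1≤s)

-- toDigits lists the least significant digit first, and its type does not
-- exclude leading zeros; the result here is the minimal representation, most
-- significant digit first.
digits : ∀ {b} → 2 ℕ.≤ b → ℕ → List (Fin b)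
digits {b} b≥2 m = dropWhile (λ d → toℕ d ℕ.≟ 0) (reverse (proj₁ (toDigits b {fromWitness b≥2} m)))

-- Positions are counted from 0, so they range over the l + 1 ∸ p values
-- 0 ≤ i ≤ l - p, and over none when l < p.
occurrences : ∀ {b p} → Vec (Fin b) p → List (Fin b) → List ℕ
occurrences {p = p} w X =
  filter (λ i → List.≡-dec Fin._≟_ (take p (drop i X)) (toList w)) (upTo (suc (length X) ℕ.∸ p))

-- The i-th term belongs to the positive integer m = suc i.
term : ∀ {b p} → 2 ℕ.≤ b → Vec (Fin b) p → ℕ → ℕ → ℚ
term b≥2 w k i =
  if does (length (occurrences w (digits b≥2 (suc i))) ℕ.≟ k) then + 1 / suc i else 0ℚ

{-# OPTIONS --safe #-}

-- For a digit string X and k ≥ 1, grow X by appending uniformly random digits. The gambling-team martingale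
-- (Li, Conway) gives the expected number of strings met with exactly k occurrences of w: it is bᵖ as soon as X has
-- fewer than k occurrences, or exactly k with the last one ending X, because both wait for the return of w from a
-- fresh occurrence. Every X of length p + k - 1 is of one of these two kinds, and shorter strings have fewer than k
-- occurrences. A number m with prefix X and n further digits satisfies 1 / (X + 1) ≤ bⁿ / m ≤ 1 / X, so S(k) lies
-- between bᵖ ∑ 1 / (X + 1) and bᵖ ∑ 1 / X over these X; so does bᵖ log b, by comparison with Riemann sums. The two
-- bounds differ by (b - 1) b^(1 - k), which is at most the claimed error.
module Submission where

open import Defs
open import Data.Bool.Base using (Bool; true; false; _∧_; if_then_else_)
open import Data.Bool.Properties using (∧-conicalˡ; ∧-conicalʳ)
open import Data.Digit using (toDigits; fromDigits)
open import Data.Fin.Base as Fin using (Fin; toℕ)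
import Data.Fin.Properties as Fin
open import Data.Integer.Base as ℤ using (ℤ; +_; -[1+_])
import Data.Integer.Properties as ℤ
import Data.Integer.Solver as ℤ-Solver
open import Data.List.Base using (List; []; _∷_; _++_; [_]; length; filter; upTo; take; drop; dropWhile; reverse)
import Data.List.Properties as List
open import Data.Nat.Base as ℕ using (ℕ; zero; suc)
open import Data.Nat.Divisibility using (divides-refl)
open import Data.Nat.DivMod hiding (_/_; _%_)
import Data.Nat.Properties as ℕ
open import Data.Product.Base using (Σ-syntax; ∃-syntax; _×_; _,_; proj₁; proj₂)
open import Data.Rational.Base hiding (truncate)
open import Data.Rational.Properties
open import Data.Rational.Solver using (module +-*-Solver)
import Data.Rational.Unnormalised.Base as ℚᵘ
import Data.Rational.Unnormalised.Properties as ℚᵘ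
open import Data.Sum.Base using (_⊎_; inj₁; inj₂)
open import Data.Vec.Base using (Vec; toList)
import Data.Vec.Properties as Vec
open import Function.Base using (_∘_)
open import Function.Bundles using (mk⇔)
open import Relation.Binary.Definitions using (tri<; tri≈; tri>)
open import Relation.Binary.PropositionalEquality hiding ([_])
open import Relation.Nullary.Decidable using (Dec; yes; no; does; fromWitness; does-⇔)
open import Relation.Nullary.Negation using (¬_; contradiction)
open import Relation.Unary using (Decidable)
open +-*-Solver using (solve; _:+_; _:*_; _:-_; :-_; _:=_; con)

-- Rational arithmetic and finite sums

-- Infinite branches and limits of expectations never occur. An expected value is represented by a
-- function `h` on the nodes with `mean h m ≡ h m - I m`, an identity about a single step, and the
-- martingale supplies such an `h` in closed form. Iterated, the identity makes `mean^ n h` the part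
-- still to come after n further digits. The value S(k) is not given in advance: its partial sums
-- must be shown to be Cauchy, so this remainder has to vanish at an explicit rate. A bound c / n is
-- enough, and it needs no exponential estimate: having at most k occurrences can be lost but never
-- regained as digits are appended. The comparison of log b with sums over one level is the same
-- tree estimate with `I` constantly 1.

0<fromℕ : ∀ n → 1 ℕ.≤ n → 0ℚ < fromℕ n
0<fromℕ n 1≤n = <-≤-trans (positive⁻¹ 1ℚ) (fromℕ-mono-≤ {1} {n} 1≤n)

*-monoˡ-≤ : ∀ {r p q} → 0ℚ ≤ r → p ≤ q → r * p ≤ r * q
*-monoˡ-≤ {r} 0≤r = *-monoˡ-≤-nonNeg r {{nonNegative 0≤r}}

*-monoʳ-≤ : ∀ {r p q} → 0ℚ ≤ r → p ≤ q → p * r ≤ q * r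
*-monoʳ-≤ {r} 0≤r = *-monoʳ-≤-nonNeg r {{nonNegative 0≤r}}

0≤* : ∀ {p q} → 0ℚ ≤ p → 0ℚ ≤ q → 0ℚ ≤ p * q
0≤* {p} {q} 0≤p 0≤q = subst (_≤ p * q) (*-zeroʳ p) (*-monoˡ-≤ 0≤p 0≤q)

0<* : ∀ {p q} → 0ℚ < p → 0ℚ < q → 0ℚ < p * q
0<* {p} {q} 0<p 0<q = subst (_< p * q) (*-zeroʳ p) (*-monoʳ-<-pos p {{positive 0<p}} 0<q)

p≤p+q : ∀ {p q} → 0ℚ ≤ q → p ≤ p + q
p≤p+q {p} {q} 0≤q = subst (_≤ p + q) (+-identityʳ p) (+-monoʳ-≤ p 0≤q)

p-q≤p : ∀ {p q} → 0ℚ ≤ q → p - q ≤ p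
p-q≤p {p} {q} 0≤q = subst (p - q ≤_) (+-identityʳ p) (+-monoʳ-≤ p (neg-antimono-≤ 0≤q))

0≤q-p : ∀ {p q} → p ≤ q → 0ℚ ≤ q - p
0≤q-p {p} {q} p≤q = subst (_≤ q - p) (+-inverseʳ p) (+-monoˡ-≤ (- p) p≤q)

p≤q+r⇒p-q≤r : ∀ {p q r} → p ≤ q + r → p - q ≤ r
p≤q+r⇒p-q≤r {p} {q} {r} p≤q+r = subst (p - q ≤_)
  (solve 2 (λ q r → q :+ r :- q := r) refl q r) (+-monoˡ-≤ (- q) p≤q+r)

p-q≤r⇒p≤q+r : ∀ {p q r} → p - q ≤ r → p ≤ q + r
p-q≤r⇒p≤q+r {p} {q} {r} p-q≤r = subst (_≤ q + r)
  (solve 2 (λ p q → q :+ (p :- q) := p) refl p q) (+-monoʳ-≤ q p-q≤r)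

∣p∣≤ : ∀ {p ε} → p ≤ ε → - p ≤ ε → ∣ p ∣ ≤ ε
∣p∣≤ {p} p≤ε -p≤ε with ∣p∣≡p∨∣p∣≡-p p
... | inj₁ eq = subst (_≤ _) (sym eq) p≤ε
... | inj₂ eq = subst (_≤ _) (sym eq) -p≤ε

∣p-q∣≤ : ∀ {p q ε} → p ≤ q + ε → q ≤ p + ε → ∣ p - q ∣ ≤ ε
∣p-q∣≤ {p} {q} p≤q+ε q≤p+ε = ∣p∣≤ (p≤q+r⇒p-q≤r p≤q+ε)
  (subst (_≤ _) (solve 2 (λ p q → q :- p := :- (p :- q)) refl p q) (p≤q+r⇒p-q≤r q≤p+ε))

p≤∣p∣ : ∀ p → p ≤ ∣ p ∣
p≤∣p∣ p with ≤-total 0ℚ p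
... | inj₁ 0≤p = ≤-reflexive (sym (0≤p⇒∣p∣≡p 0≤p))
... | inj₂ p≤0 = ≤-trans p≤0 (0≤∣p∣ p)

recip-inverse : ∀ {q} → 0ℚ < q → q * recip q ≡ 1ℚ
recip-inverse {q} 0<q with q ≟ 0ℚ
... | yes q≡0 = contradiction (sym q≡0) (<⇒≢ 0<q)
... | no q≢0  = *-inverseʳ q {{≢-nonZero q≢0}}

recip-unique : ∀ {p q} → 0ℚ < p → p * q ≡ 1ℚ → q ≡ recip p
recip-unique {p} {q} 0<p pq≡1 = begin
  q                   ≡⟨ *-identityʳ q ⟨
  q * 1ℚ              ≡⟨ cong (q *_) (recip-inverse 0<p) ⟨
  q * (p * recip p)   ≡⟨ solve 3 (λ q p r → q :* (p :* r) := p :* q :* r) refl q p (recip p) ⟩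
  p * q * recip p     ≡⟨ cong (_* recip p) pq≡1 ⟩
  1ℚ * recip p        ≡⟨ *-identityˡ (recip p) ⟩
  recip p             ∎
  where open ≡-Reasoning

recip-* : ∀ {p q} → 0ℚ < p → 0ℚ < q → recip (p * q) ≡ recip p * recip q
recip-* {p} {q} 0<p 0<q = sym (recip-unique (0<* 0<p 0<q) (begin
  p * q * (recip p * recip q)     ≡⟨ solve 4 (λ p q r s → p :* q :* (r :* s) := p :* r :* (q :* s)) refl p q (recip p) (recip q) ⟩
  p * recip p * (q * recip q)     ≡⟨ cong₂ _*_ (recip-inverse 0<p) (recip-inverse 0<q) ⟩
  1ℚ * 1ℚ                         ≡⟨⟩
  1ℚ                              ∎))
  where open ≡-Reasoning

0≤recip : ∀ {q} → 0ℚ < q → 0ℚ ≤ recip q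
0≤recip {q} 0<q with q ≟ 0ℚ
... | yes _  = ≤-refl
... | no q≢0 = <⇒≤ (positive⁻¹ _ {{1/pos⇒pos q {{positive 0<q}}}})

0<recip : ∀ {q} → 0ℚ < q → 0ℚ < recip q
0<recip {q} 0<q = ≰⇒> λ recip≤0 → <⇒≢ (positive⁻¹ 1ℚ) (sym (begin
  1ℚ            ≡⟨ recip-inverse 0<q ⟨
  q * recip q   ≡⟨ cong (q *_) (≤-antisym recip≤0 (0≤recip 0<q)) ⟩
  q * 0ℚ        ≡⟨ *-zeroʳ q ⟩
  0ℚ            ∎))
  where open ≡-Reasoning

recip-anti-≤ : ∀ {p q} → 0ℚ < p → p ≤ q → recip q ≤ recip p
recip-anti-≤ {p} {q} 0<p p≤q = begin
  recip q                   ≡⟨ *-identityʳ (recip q) ⟨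
  recip q * 1ℚ              ≡⟨ cong (recip q *_) (recip-inverse 0<p) ⟨
  recip q * (p * recip p)   ≤⟨ *-monoˡ-≤ (0≤recip 0<q) (*-monoʳ-≤ (0≤recip 0<p) p≤q) ⟩
  recip q * (q * recip p)   ≡⟨ solve 3 (λ a b c → a :* (b :* c) := b :* a :* c) refl (recip q) q (recip p) ⟩
  q * recip q * recip p     ≡⟨ cong (_* recip p) (recip-inverse 0<q) ⟩
  1ℚ * recip p              ≡⟨ *-identityˡ (recip p) ⟩
  recip p                   ∎
  where
  open ≤-Reasoning
  0<q = <-≤-trans 0<p p≤q

recipℕ : ℕ → ℚ
recipℕ n = recip (fromℕ n)

recipℕ-anti-≤ : ∀ m n → 1 ℕ.≤ m → m ℕ.≤ n → recipℕ n ≤ recipℕ m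
recipℕ-anti-≤ m n 1≤m m≤n = recip-anti-≤ (0<fromℕ m 1≤m) (fromℕ-mono-≤ m≤n)

0≤recipℕ : ∀ n → 1 ℕ.≤ n → 0ℚ ≤ recipℕ n
0≤recipℕ n 1≤n = 0≤recip (0<fromℕ n 1≤n)

recipℕ-inverse : ∀ n → 1 ℕ.≤ n → fromℕ n * recipℕ n ≡ 1ℚ
recipℕ-inverse n 1≤n = recip-inverse (0<fromℕ n 1≤n)

recipℕ-* : ∀ m n → 1 ℕ.≤ m → 1 ℕ.≤ n → recipℕ (m ℕ.* n) ≡ recipℕ m * recipℕ n
recipℕ-* m n 1≤m 1≤n = trans (cong recip (fromℕ-* m n)) (recip-* (0<fromℕ m 1≤m) (0<fromℕ n 1≤n))

*-recipℕ : ∀ n → 1 ℕ.≤ n → ∀ q → fromℕ n * (recipℕ n * q) ≡ q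
*-recipℕ n 1≤n q = trans (sym (*-assoc (fromℕ n) (recipℕ n) q))
  (trans (cong (_* q) (recipℕ-inverse n 1≤n)) (*-identityˡ q))

1/suc≡recipℕ : ∀ n → + 1 / suc n ≡ recipℕ (suc n)
1/suc≡recipℕ n = recip-unique (0<fromℕ (suc n) (ℕ.s≤s ℕ.z≤n)) (toℚᵘ-injective (begin
  toℚᵘ (fromℕ (suc n) * (+ 1 / suc n))              ≈⟨ toℚᵘ-homo-* (fromℕ (suc n)) (+ 1 / suc n) ⟩
  toℚᵘ (fromℕ (suc n)) ℚᵘ.* toℚᵘ (+ 1 / suc n)      ≈⟨ ℚᵘ.*-cong (toℚᵘ-fromℚᵘ (ℚᵘ.mkℚᵘ (+ suc n) 0)) (toℚᵘ-fromℚᵘ (ℚᵘ.mkℚᵘ (+ 1) n)) ⟩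
  ℚᵘ.mkℚᵘ (+ suc n) 0 ℚᵘ.* ℚᵘ.mkℚᵘ (+ 1) n          ≈⟨ ℚᵘ.*≡* (cong +_ cross) ⟩
  toℚᵘ 1ℚ                                           ∎))
  where
  open import Relation.Binary.Reasoning.Setoid ℚᵘ.≃-setoid
  cross : suc n ℕ.* 1 ℕ.* 1 ≡ 1 ℕ.* (1 ℕ.* suc n)
  cross = trans (cong (ℕ._* 1) (ℕ.*-identityʳ (suc n))) (trans (ℕ.*-identityʳ (suc n))
    (sym (trans (ℕ.*-identityˡ (1 ℕ.* suc n)) (ℕ.*-identityˡ (suc n)))))

fromℕ-^ : ∀ b n → fromℕ b ^ n ≡ fromℕ (b ℕ.^ n)
fromℕ-^ b zero    = refl
fromℕ-^ b (suc n) = trans (cong (fromℕ b *_) (fromℕ-^ b n)) (sym (fromℕ-* b (b ℕ.^ n)))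

≤fromℕ : ∀ p → p ≤ fromℕ ℤ.∣ ↥ p ∣
≤fromℕ p@(mkℚ n d _) = toℚᵘ-cancel-≤ (begin
  ℚᵘ.mkℚᵘ n d              ≤⟨ ℚᵘ.*≤* (bound n) ⟩
  ℚᵘ.mkℚᵘ (+ ℤ.∣ n ∣) 0    ≃⟨ toℚᵘ-fromℚᵘ (ℚᵘ.mkℚᵘ (+ ℤ.∣ n ∣) 0) ⟨
  toℚᵘ (fromℕ ℤ.∣ n ∣)     ∎)
  where
  open ℚᵘ.≤-Reasoning
  bound : ∀ n → n ℤ.* + 1 ℤ.≤ (+ ℤ.∣ n ∣) ℤ.* + suc d
  bound (+ n)    = subst₂ ℤ._≤_ (ℤ.pos-* n 1) (ℤ.pos-* n (suc d))
                     (ℤ.+≤+ (ℕ.*-monoʳ-≤ n (ℕ.s≤s ℕ.z≤n)))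
  bound -[1+ n ] = ℤ.-≤+

archimedean : ∀ c ε → 0ℚ < ε → ∃[ n ] (1 ℕ.≤ n × c * recipℕ n ≤ ε)
archimedean c ε 0<ε = n , ℕ.s≤s ℕ.z≤n , (begin
  c * recipℕ n                      ≡⟨ cong (_* recipℕ n) (trans (sym (*-identityˡ c)) (cong (_* c) (sym (recip-inverse 0<ε)))) ⟩
  ε * recip ε * c * recipℕ n        ≡⟨ solve 4 (λ e r c n → e :* r :* c :* n := e :* ((c :* r) :* n)) refl ε (recip ε) c (recipℕ n) ⟩
  ε * (c * recip ε * recipℕ n)      ≤⟨ *-monoˡ-≤ (<⇒≤ 0<ε) (*-monoʳ-≤ (0≤recipℕ n (ℕ.s≤s ℕ.z≤n)) r≤n) ⟩
  ε * (fromℕ n * recipℕ n)          ≡⟨ cong (ε *_) (recipℕ-inverse n (ℕ.s≤s ℕ.z≤n)) ⟩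
  ε * 1ℚ                            ≡⟨ *-identityʳ ε ⟩
  ε                                 ∎)
  where
  open ≤-Reasoning
  r = c * recip ε
  n = suc ℤ.∣ ↥ r ∣
  r≤n : r ≤ fromℕ n
  r≤n = ≤-trans (≤fromℕ r) (fromℕ-mono-≤ {ℤ.∣ ↥ r ∣} {n} (ℕ.n≤1+n ℤ.∣ ↥ r ∣))

∑-cong : ∀ n {f g} → (∀ i → i ℕ.< n → f i ≡ g i) → ∑< n f ≡ ∑< n g
∑-cong zero    f≡g = refl
∑-cong (suc n) f≡g = cong₂ _+_ (∑-cong n (λ i i<n → f≡g i (ℕ.m<n⇒m<1+n i<n))) (f≡g n ℕ.≤-refl)

∑-mono : ∀ n {f g} → (∀ i → i ℕ.< n → f i ≤ g i) → ∑< n f ≤ ∑< n g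
∑-mono zero    f≤g = ≤-refl
∑-mono (suc n) f≤g = +-mono-≤ (∑-mono n (λ i i<n → f≤g i (ℕ.m<n⇒m<1+n i<n))) (f≤g n ℕ.≤-refl)

∑-split : ∀ m n f → ∑< (n ℕ.+ m) f ≡ ∑< m f + ∑< n (λ i → f (i ℕ.+ m))
∑-split m zero    f = sym (+-identityʳ _)
∑-split m (suc n) f = trans (cong (_+ f (n ℕ.+ m)) (∑-split m n f))
  (+-assoc (∑< m f) (∑< n (λ i → f (i ℕ.+ m))) (f (n ℕ.+ m)))

∑-suc : ∀ n f → ∑< (suc n) f ≡ f 0 + ∑< n (λ i → f (suc i))
∑-suc zero    f = trans (+-identityˡ (f 0)) (sym (+-identityʳ (f 0)))
∑-suc (suc n) f = trans (cong (_+ f (suc n)) (∑-suc n f)) (+-assoc (f 0) _ (f (suc n)))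

∑-+ : ∀ n f g → ∑< n (λ i → f i + g i) ≡ ∑< n f + ∑< n g
∑-+ zero    f g = refl
∑-+ (suc n) f g = trans (cong (_+ (f n + g n)) (∑-+ n f g))
  (solve 4 (λ a b c d → a :+ b :+ (c :+ d) := a :+ c :+ (b :+ d)) refl (∑< n f) (∑< n g) (f n) (g n))

∑-*ˡ : ∀ n c f → ∑< n (λ i → c * f i) ≡ c * ∑< n f
∑-*ˡ zero    c f = sym (*-zeroʳ c)
∑-*ˡ (suc n) c f = trans (cong (_+ c * f n) (∑-*ˡ n c f)) (sym (*-distribˡ-+ c (∑< n f) (f n)))

∑-const : ∀ n c → ∑< n (λ _ → c) ≡ fromℕ n * c
∑-const zero    c = sym (*-zeroˡ c)
∑-const (suc n) c = begin
  ∑< n (λ _ → c) + c    ≡⟨ cong (_+ c) (∑-const n c) ⟩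
  fromℕ n * c + c       ≡⟨ solve 2 (λ x c → x :* c :+ c := (con 1ℚ :+ x) :* c) refl (fromℕ n) c ⟩
  (1ℚ + fromℕ n) * c    ≡⟨ cong (_* c) (fromℕ-+ 1 n) ⟨
  fromℕ (suc n) * c     ∎
  where open ≡-Reasoning

∑-nonneg : ∀ n {f} → (∀ i → i ℕ.< n → 0ℚ ≤ f i) → 0ℚ ≤ ∑< n f
∑-nonneg n 0≤f = subst (_≤ ∑< n _) (trans (∑-const n 0ℚ) (*-zeroʳ (fromℕ n))) (∑-mono n 0≤f)

∑-length-mono : ∀ {m n} {f} → (∀ i → 0ℚ ≤ f i) → m ℕ.≤ n → ∑< m f ≤ ∑< n f
∑-length-mono {m} {n} {f} 0≤f m≤n = subst (λ l → ∑< m f ≤ ∑< l f) (ℕ.m∸n+n≡m m≤n)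
  (subst (∑< m f ≤_) (sym (∑-split m (n ℕ.∸ m) f)) (p≤p+q (∑-nonneg (n ℕ.∸ m) (λ i _ → 0≤f (i ℕ.+ m)))))

∑-zero : ∀ n {f} → (∀ i → i ℕ.< n → f i ≡ 0ℚ) → ∑< n f ≡ 0ℚ
∑-zero n f≡0 = trans (∑-cong n f≡0) (trans (∑-const n 0ℚ) (*-zeroʳ (fromℕ n)))

∑-telescope : ∀ n (f : ℕ → ℚ) → ∑< n (λ i → f i - f (suc i)) ≡ f 0 - f n
∑-telescope zero    f = sym (+-inverseʳ (f 0))
∑-telescope (suc n) f = trans (cong (_+ (f n - f (suc n))) (∑-telescope n f))
  (solve 3 (λ a b c → a :- b :+ (b :- c) := a :- c) refl (f 0) (f n) (f (suc n)))

∑-single : ∀ n {f c} j → j ℕ.< n → f j ≡ c → (∀ i → i ℕ.< n → i ≢ j → f i ≡ 0ℚ) → ∑< n f ≡ c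
∑-single (suc n) {f} {c} j j<1+n fj≡c f≡0 with j ℕ.≟ n
... | yes refl = trans (cong₂ _+_ (∑-zero n λ i i<n → f≡0 i (ℕ.m<n⇒m<1+n i<n) (ℕ.<⇒≢ i<n)) fj≡c) (+-identityˡ c)
... | no j≢n   = trans (cong₂ _+_
  (∑-single n j (ℕ.≤∧≢⇒< (ℕ.s≤s⁻¹ j<1+n) j≢n) fj≡c (λ i i<n → f≡0 i (ℕ.m<n⇒m<1+n i<n)))
  (f≡0 n ℕ.≤-refl (λ n≡j → j≢n (sym n≡j)))) (+-identityʳ c)

-- Averaging over the tree of digit strings

-- The natural numbers form a b-ary tree: appending the digit d to m gives d + m * b.
module Tree (b : ℕ) (b≥2 : 2 ℕ.≤ b) where

  b≥1 : 1 ℕ.≤ b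
  b≥1 = ℕ.≤-trans (ℕ.n≤1+n 1) b≥2

  m≤child : ∀ d m → m ℕ.≤ d ℕ.+ m ℕ.* b
  m≤child d m = ℕ.≤-trans (ℕ.≤-trans (ℕ.≤-reflexive (sym (ℕ.*-identityʳ m))) (ℕ.*-monoʳ-≤ m b≥1))
    (ℕ.m≤n+m (m ℕ.* b) d)

  b^n≥1 : ∀ n → 1 ℕ.≤ b ℕ.^ n
  b^n≥1 n = ℕ.m^n>0 b {{ℕ.>-nonZero b≥1}} n

  n<b^n : ∀ n → n ℕ.< b ℕ.^ n
  n<b^n zero    = ℕ.s≤s ℕ.z≤n
  n<b^n (suc n) = begin
    suc (suc n)            ≤⟨ ℕ.+-mono-≤ (b^n≥1 n) (n<b^n n) ⟩
    b ℕ.^ n ℕ.+ b ℕ.^ n    ≡⟨ cong (b ℕ.^ n ℕ.+_) (ℕ.+-identityʳ (b ℕ.^ n)) ⟨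
    2 ℕ.* b ℕ.^ n          ≤⟨ ℕ.*-monoˡ-≤ (b ℕ.^ n) b≥2 ⟩
    b ℕ.^ suc n            ∎
    where open ℕ.≤-Reasoning

  branch mean : (ℕ → ℚ) → ℕ → ℚ
  branch f m = ∑< b (λ d → f (d ℕ.+ m ℕ.* b))
  mean f m   = recipℕ b * branch f m

  branch^ mean^ : ℕ → (ℕ → ℚ) → ℕ → ℚ
  branch^ zero    f = f
  branch^ (suc n) f = branch (branch^ n f)
  mean^ zero    f = f
  mean^ (suc n) f = mean (mean^ n f)

  mean-mono : ∀ m (f g : ℕ → ℚ) → (∀ d → d ℕ.< b → f (d ℕ.+ m ℕ.* b) ≤ g (d ℕ.+ m ℕ.* b)) → mean f m ≤ mean g m
  mean-mono m f g f≤g = *-monoˡ-≤ (0≤recipℕ b b≥1) (∑-mono b f≤g)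

  mean-+ : ∀ m f g → mean (λ c → f c + g c) m ≡ mean f m + mean g m
  mean-+ m f g = trans (cong (recipℕ b *_) (∑-+ b (λ d → f (d ℕ.+ m ℕ.* b)) (λ d → g (d ℕ.+ m ℕ.* b))))
    (*-distribˡ-+ (recipℕ b) (branch f m) (branch g m))

  mean-*ˡ : ∀ m c f → mean (λ n → c * f n) m ≡ c * mean f m
  mean-*ˡ m c f = trans (cong (recipℕ b *_) (∑-*ˡ b c (λ d → f (d ℕ.+ m ℕ.* b))))
    (solve 3 (λ r c x → r :* (c :* x) := c :* (r :* x)) refl (recipℕ b) c (branch f m))

  mean-- : ∀ m f g → mean (λ c → f c - g c) m ≡ mean f m - mean g m
  mean-- m f g = begin
    mean (λ c → f c - g c) m             ≡⟨ cong (recipℕ b *_) (∑-cong b λ d _ → cong (_+_ (f (d ℕ.+ m ℕ.* b))) (-≡ (g (d ℕ.+ m ℕ.* b)))) ⟩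
    mean (λ c → f c + - 1ℚ * g c) m      ≡⟨ mean-+ m f (λ c → - 1ℚ * g c) ⟩
    mean f m + mean (λ c → - 1ℚ * g c) m ≡⟨ cong (_+_ (mean f m)) (trans (mean-*ˡ m (- 1ℚ) g) (sym (-≡ (mean g m)))) ⟩
    mean f m - mean g m                  ∎
    where
    open ≡-Reasoning
    -≡ : ∀ x → - x ≡ - 1ℚ * x
    -≡ = solve 1 (λ x → :- x := con (- 1ℚ) :* x) refl

  mean-const : ∀ m c → mean (λ _ → c) m ≡ c
  mean-const m c = begin
    recipℕ b * ∑< b (λ _ → c)     ≡⟨ cong (recipℕ b *_) (∑-const b c) ⟩
    recipℕ b * (fromℕ b * c)      ≡⟨ solve 3 (λ r b c → r :* (b :* c) := b :* (r :* c)) refl (recipℕ b) (fromℕ b) c ⟩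
    fromℕ b * (recipℕ b * c)      ≡⟨ *-recipℕ b b≥1 c ⟩
    c                             ∎
    where open ≡-Reasoning

  mean^-const : ∀ n m c → mean^ n (λ _ → c) m ≡ c
  mean^-const zero    m c = refl
  mean^-const (suc n) m c = trans (cong (recipℕ b *_) (∑-cong b (λ d _ → mean^-const n (d ℕ.+ m ℕ.* b) c))) (mean-const m c)

  mean^-mono : ∀ n m {f g} → (∀ c → m ℕ.≤ c → f c ≤ g c) → mean^ n f m ≤ mean^ n g m
  mean^-mono zero    m f≤g = f≤g m ℕ.≤-refl
  mean^-mono (suc n) m {f} {g} f≤g = mean-mono m (mean^ n f) (mean^ n g) λ d _ →
    mean^-mono n (d ℕ.+ m ℕ.* b) (λ c d+mb≤c → f≤g c (ℕ.≤-trans (m≤child d m) d+mb≤c))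

  mean^-*ˡ : ∀ n m c f → mean^ n (λ i → c * f i) m ≡ c * mean^ n f m
  mean^-*ˡ zero    m c f = refl
  mean^-*ˡ (suc n) m c f = trans (cong (recipℕ b *_) (∑-cong b λ d _ → mean^-*ˡ n (d ℕ.+ m ℕ.* b) c f))
    (mean-*ˡ m c (mean^ n f))

  mean^-nonneg : ∀ n m {f} → (∀ c → m ℕ.≤ c → 0ℚ ≤ f c) → 0ℚ ≤ mean^ n f m
  mean^-nonneg n m 0≤f = subst (_≤ mean^ n _ m) (mean^-const n m 0ℚ) (mean^-mono n m 0≤f)

  -- The children of consecutive numbers are again consecutive, so a sum over a block of children
  -- can be regrouped by parent.
  ∑-branch : ∀ l u f → ∑< (l ℕ.* b) (λ i → f (i ℕ.+ u ℕ.* b)) ≡ ∑< l (λ i → branch f (i ℕ.+ u))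
  ∑-branch zero    u f = refl
  ∑-branch (suc l) u f = begin
    ∑< (b ℕ.+ l ℕ.* b) (λ i → f (i ℕ.+ u ℕ.* b))
      ≡⟨ ∑-split (l ℕ.* b) b (λ i → f (i ℕ.+ u ℕ.* b)) ⟩
    ∑< (l ℕ.* b) (λ i → f (i ℕ.+ u ℕ.* b)) + ∑< b (λ i → f (i ℕ.+ l ℕ.* b ℕ.+ u ℕ.* b))
      ≡⟨ cong₂ _+_ (∑-branch l u f) (∑-cong b λ i _ → cong f
           (trans (ℕ.+-assoc i (l ℕ.* b) (u ℕ.* b)) (cong (i ℕ.+_) (sym (ℕ.*-distribʳ-+ b l u))))) ⟩
    ∑< l (λ i → branch f (i ℕ.+ u)) + branch f (l ℕ.+ u) ∎
    where open ≡-Reasoning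

  ∑-branch^ : ∀ n l u f → ∑< (l ℕ.* b ℕ.^ n) (λ i → f (i ℕ.+ u ℕ.* b ℕ.^ n)) ≡ ∑< l (λ i → branch^ n f (i ℕ.+ u))
  ∑-branch^ zero    l u f = trans (cong (λ n → ∑< n _) (ℕ.*-identityʳ l))
    (∑-cong l λ i _ → cong (λ n → f (i ℕ.+ n)) (ℕ.*-identityʳ u))
  ∑-branch^ (suc n) l u f = begin
    ∑< (l ℕ.* (b ℕ.* b ℕ.^ n)) (λ i → f (i ℕ.+ u ℕ.* (b ℕ.* b ℕ.^ n)))
      ≡⟨ cong₂ (λ x y → ∑< x (λ i → f (i ℕ.+ y))) (sym (ℕ.*-assoc l b (b ℕ.^ n))) (sym (ℕ.*-assoc u b (b ℕ.^ n))) ⟩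
    ∑< (l ℕ.* b ℕ.* b ℕ.^ n) (λ i → f (i ℕ.+ u ℕ.* b ℕ.* b ℕ.^ n))
      ≡⟨ ∑-branch^ n (l ℕ.* b) (u ℕ.* b) f ⟩
    ∑< (l ℕ.* b) (λ i → branch^ n f (i ℕ.+ u ℕ.* b))
      ≡⟨ ∑-branch l u (branch^ n f) ⟩
    ∑< l (λ i → branch^ (suc n) f (i ℕ.+ u)) ∎
    where open ≡-Reasoning

  module _ {I : ℕ → ℚ} (0≤I : ∀ m → 0ℚ ≤ I m) where

    private
      recip-child : ∀ m → 1 ℕ.≤ m → ∀ f → branch (λ c → recipℕ (m ℕ.* b) * f c) m ≡ recipℕ m * mean f m
      recip-child m 1≤m f = begin
        branch (λ c → recipℕ (m ℕ.* b) * f c) m    ≡⟨ ∑-*ˡ b (recipℕ (m ℕ.* b)) _ ⟩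
        recipℕ (m ℕ.* b) * branch f m              ≡⟨ cong (_* branch f m) (recipℕ-* m b 1≤m b≥1) ⟩
        recipℕ m * recipℕ b * branch f m           ≡⟨ *-assoc (recipℕ m) (recipℕ b) (branch f m) ⟩
        recipℕ m * mean f m                        ∎
        where open ≡-Reasoning

    -- A child is at least m * b, so its reciprocal is at most 1 / b times that of m. The factor 1 /
    -- b turns the sum over the children into a mean, and the factor 1 / m is reproduced at each
    -- level.
    branch^-upper : ∀ {F} → (∀ m → 1 ℕ.≤ m → F m ≤ recipℕ m * I m) →
                    ∀ n m → 1 ℕ.≤ m → branch^ n F m ≤ recipℕ m * mean^ n I m
    branch^-upper F≤ zero    m 1≤m = F≤ m 1≤m
    branch^-upper F≤ (suc n) m 1≤m = subst (branch^ (suc n) _ m ≤_) (recip-child m 1≤m (mean^ n I))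
      (∑-mono b λ d _ → ≤-trans (branch^-upper F≤ n (d ℕ.+ m ℕ.* b) (ℕ.≤-trans 1≤m (m≤child d m)))
        (*-monoʳ-≤ (mean^-nonneg n (d ℕ.+ m ℕ.* b) (λ c _ → 0≤I c))
          (recipℕ-anti-≤ (m ℕ.* b) (d ℕ.+ m ℕ.* b) (ℕ.≤-trans 1≤m (m≤child 0 m)) (ℕ.m≤n+m (m ℕ.* b) d))))

    -- The shift by one is what survives appending a digit: d < b gives d + m * b + 1 ≤ (m + 1) * b.
    branch^-lower : ∀ {F} → (∀ m → 1 ℕ.≤ m → recipℕ (suc m) * I m ≤ F m) →
                    ∀ n m → 1 ℕ.≤ m → recipℕ (suc m) * mean^ n I m ≤ branch^ n F m
    branch^-lower ≤F zero    m 1≤m = ≤F m 1≤m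
    branch^-lower {F} ≤F (suc n) m 1≤m = subst (_≤ branch^ (suc n) F m) eq
      (∑-mono b λ d d<b → ≤-trans
        (*-monoʳ-≤ (mean^-nonneg n (d ℕ.+ m ℕ.* b) (λ c _ → 0≤I c))
          (recipℕ-anti-≤ (suc (d ℕ.+ m ℕ.* b)) (suc m ℕ.* b) (ℕ.s≤s ℕ.z≤n) (ℕ.+-monoˡ-≤ (m ℕ.* b) d<b)))
        (branch^-lower ≤F n (d ℕ.+ m ℕ.* b) (ℕ.≤-trans 1≤m (m≤child d m))))
      where
      open ≡-Reasoning
      eq : ∑< b (λ d → recipℕ (suc m ℕ.* b) * mean^ n I (d ℕ.+ m ℕ.* b)) ≡ recipℕ (suc m) * mean^ (suc n) I m
      eq = begin
        ∑< b (λ d → recipℕ (suc m ℕ.* b) * mean^ n I (d ℕ.+ m ℕ.* b))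
          ≡⟨ ∑-*ˡ b (recipℕ (suc m ℕ.* b)) _ ⟩
        recipℕ (suc m ℕ.* b) * branch (mean^ n I) m
          ≡⟨ cong (_* branch (mean^ n I) m) (recipℕ-* (suc m) b (ℕ.s≤s ℕ.z≤n) b≥1) ⟩
        recipℕ (suc m) * recipℕ b * branch (mean^ n I) m
          ≡⟨ *-assoc (recipℕ (suc m)) (recipℕ b) _ ⟩
        recipℕ (suc m) * mean^ (suc n) I m ∎

  -- h m is the expected total of I along a random branch starting at m.
  module Potential (m₀ : ℕ) (h I : ℕ → ℚ) (mean-h : ∀ m → m₀ ℕ.≤ m → mean h m ≡ h m - I m) where

    mean^-step : ∀ n m → m₀ ℕ.≤ m → mean^ (suc n) h m ≡ mean^ n h m - mean^ n I m
    mean^-step zero    m m₀≤m = mean-h m m₀≤m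
    mean^-step (suc n) m m₀≤m = trans
      (cong (recipℕ b *_) (∑-cong b λ d _ → mean^-step n (d ℕ.+ m ℕ.* b) (ℕ.≤-trans m₀≤m (m≤child d m))))
      (mean-- m (mean^ n h) (mean^ n I))

    -- If I decreases along branches, n * mean^ n I is at most the sum of the first n means.
    mean^-decay : (∀ m → 0ℚ ≤ h m) → (∀ m → m₀ ℕ.≤ m → ∀ d → d ℕ.< b → I (d ℕ.+ m ℕ.* b) ≤ I m) →
                  ∀ n m → m₀ ℕ.≤ m → fromℕ n * mean^ n I m ≤ h m
    mean^-decay 0≤h I↓ n m m₀≤m = ≤-trans (partial n)
      (p-q≤p (mean^-nonneg n m (λ c _ → 0≤h c)))
      where
      mean^-anti : ∀ n m → m₀ ℕ.≤ m → mean^ (suc n) I m ≤ mean^ n I m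
      mean^-anti zero    m m₀≤m = subst (mean I m ≤_) (mean-const m (I m))
        (*-monoˡ-≤ (0≤recipℕ b b≥1) (∑-mono b (I↓ m m₀≤m)))
      mean^-anti (suc n) m m₀≤m = mean-mono m (mean^ (suc n) I) (mean^ n I) λ d _ → mean^-anti n (d ℕ.+ m ℕ.* b) (ℕ.≤-trans m₀≤m (m≤child d m))

      partial : ∀ n → fromℕ n * mean^ n I m ≤ h m - mean^ n h m
      partial zero    = ≤-reflexive (trans (*-zeroˡ (I m)) (sym (+-inverseʳ (h m))))
      partial (suc n) = begin
        fromℕ (suc n) * mean^ (suc n) I m     ≤⟨ *-monoˡ-≤ (0≤fromℕ (suc n)) (mean^-anti n m m₀≤m) ⟩
        fromℕ (suc n) * x                     ≡⟨ cong (_* x) (fromℕ-+ 1 n) ⟩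
        (1ℚ + fromℕ n) * x                    ≡⟨ solve 2 (λ n x → (con 1ℚ :+ n) :* x := n :* x :+ x) refl (fromℕ n) x ⟩
        fromℕ n * x + x                       ≤⟨ +-monoˡ-≤ x (partial n) ⟩
        h m - mean^ n h m + x                 ≡⟨ solve 3 (λ h y x → h :- y :+ x := h :- (y :- x)) refl (h m) (mean^ n h m) x ⟩
        h m - (mean^ n h m - x)               ≡⟨ cong (_-_ (h m)) (mean^-step n m m₀≤m) ⟨
        h m - mean^ (suc n) h m               ∎
        where
        open ≤-Reasoning
        x = mean^ n I m

-- Convergence of series, and bounds by sums over one level of the tree

-- Nonnegative terms make the partial sums increase, so a one-sided bound against a single `N`
-- controls differences of both signs.
∑-partial-cauchy : ∀ f → (∀ i → 0ℚ ≤ f i) →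
  (∀ ε → 0ℚ < ε → ∃[ N ] (∀ n → ∑< n f ≤ ∑< N f + ε)) → Cauchy (λ n → ∑< n f)
∑-partial-cauchy f 0≤f tail ε 0<ε = let N , bound = tail ε 0<ε in
  N , λ m n N≤m N≤n → ∣p-q∣≤
    (≤-trans (bound m) (+-monoˡ-≤ ε (∑-length-mono 0≤f N≤n)))
    (≤-trans (bound n) (+-monoˡ-≤ ε (∑-length-mono 0≤f N≤m)))

Cauchy⇒HasSum : ∀ f (cauchy : Cauchy (λ n → ∑< n f)) → HasSum f (mkℝ (λ n → ∑< n f) cauchy)
Cauchy⇒HasSum f cauchy ε 0<ε = let N , close = cauchy ε 0<ε in
  N , λ n N≤n δ 0<δ → N , λ m N≤m → ≤-trans (close n m N≤n N≤m) (p≤p+q (<⇒≤ 0<δ))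

-- The numbers from u up to u * b serve as roots: their descendants after n digits are exactly the
-- numbers from u * b^n up to u * b^(n+1), so every number at least u descends from exactly one
-- root.
module Level (b : ℕ) (b≥2 : 2 ℕ.≤ b) (u : ℕ) (u≥1 : 1 ℕ.≤ u) where

  open Tree b b≥2

  l : ℕ
  l = (b ℕ.∸ 1) ℕ.* u

  1≤b-1 : 1 ℕ.≤ b ℕ.∸ 1
  1≤b-1 = ℕ.∸-monoˡ-≤ 1 b≥2

  -- The numbers u ≤ X < u * b.
  ∑ᵤ : (ℕ → ℚ) → ℚ
  ∑ᵤ f = ∑< l (λ i → f (i ℕ.+ u))

  l+u≡u*b : l ℕ.+ u ≡ u ℕ.* b
  l+u≡u*b = begin
    (b ℕ.∸ 1) ℕ.* u ℕ.+ u    ≡⟨ ℕ.+-comm _ u ⟩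
    suc (b ℕ.∸ 1) ℕ.* u      ≡⟨ cong (ℕ._* u) (ℕ.m+[n∸m]≡n b≥1) ⟩
    b ℕ.* u                  ≡⟨ ℕ.*-comm b u ⟩
    u ℕ.* b                  ∎
    where open ≡-Reasoning

  lo hi : ℚ
  lo = ∑ᵤ (λ m → recipℕ (suc m))
  hi = ∑ᵤ recipℕ

  -- The difference of the two sums telescopes to 1 / u - 1 / (u * b).
  hi≡lo+gap : hi ≡ lo + (fromℕ b - 1ℚ) * recipℕ (u ℕ.* b)
  hi≡lo+gap = begin
    hi
      ≡⟨ solve 2 (λ x y → x := y :+ (x :+ con (- 1ℚ) :* y)) refl hi lo ⟩
    lo + (hi + - 1ℚ * lo)
      ≡⟨ cong (λ x → lo + (hi + x)) (sym (∑-*ˡ l (- 1ℚ) (λ i → recipℕ (suc (i ℕ.+ u))))) ⟩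
    lo + (hi + ∑< l (λ i → - 1ℚ * recipℕ (suc (i ℕ.+ u))))
      ≡⟨ cong (_+_ lo) (sym (∑-+ l (λ i → recipℕ (i ℕ.+ u)) (λ i → - 1ℚ * recipℕ (suc (i ℕ.+ u))))) ⟩
    lo + ∑< l (λ i → recipℕ (i ℕ.+ u) + - 1ℚ * recipℕ (suc (i ℕ.+ u)))
      ≡⟨ cong (_+_ lo) (∑-cong l λ i _ → solve 2 (λ x y → x :+ con (- 1ℚ) :* y := x :- y) refl (recipℕ (i ℕ.+ u)) (recipℕ (suc (i ℕ.+ u)))) ⟩
    lo + ∑< l (λ i → recipℕ (i ℕ.+ u) - recipℕ (suc (i ℕ.+ u)))
      ≡⟨ cong (_+_ lo) (∑-telescope l (λ i → recipℕ (i ℕ.+ u))) ⟩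
    lo + (recipℕ u - recipℕ (l ℕ.+ u))
      ≡⟨ cong₂ (λ x y → lo + (x - recipℕ y)) (sym (*-recipℕ b b≥1 (recipℕ u))) l+u≡u*b ⟩
    lo + (fromℕ b * (recipℕ b * recipℕ u) - recipℕ (u ℕ.* b))
      ≡⟨ cong (λ x → lo + (fromℕ b * x - recipℕ (u ℕ.* b))) (trans (*-comm (recipℕ b) (recipℕ u)) (sym (recipℕ-* u b u≥1 b≥1))) ⟩
    lo + (fromℕ b * recipℕ (u ℕ.* b) - recipℕ (u ℕ.* b))
      ≡⟨ cong (_+_ lo) (solve 2 (λ b r → b :* r :- r := (b :- con 1ℚ) :* r) refl (fromℕ b) (recipℕ (u ℕ.* b))) ⟩
    lo + (fromℕ b - 1ℚ) * recipℕ (u ℕ.* b) ∎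
    where open ≡-Reasoning

  -- The Riemann sum with (b - 1) * q intervals has nodes (q + i) / q.
  riemannSum-recip : ∀ n q → 1 ℕ.≤ q → suc n ≡ (b ℕ.∸ 1) ℕ.* q →
    riemannSum recip 1ℚ (fromℕ b) n ≡ ∑< ((b ℕ.∸ 1) ℕ.* q) (λ i → recipℕ (suc (i ℕ.+ q)))
  riemannSum-recip n q q≥1 eq = trans (∑-cong (suc n) λ i _ → step i)
    (cong (λ x → ∑< x (λ i → recipℕ (suc (i ℕ.+ q)))) eq)
    where
    open ≡-Reasoning
    h = (fromℕ b - 1ℚ) * recipℕ (suc n)
    r = recipℕ q
    b-1 : fromℕ b - 1ℚ ≡ fromℕ (b ℕ.∸ 1)
    b-1 = begin
      fromℕ b - 1ℚ                        ≡⟨ cong (λ x → fromℕ x - 1ℚ) (ℕ.m+[n∸m]≡n b≥1) ⟨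
      fromℕ (1 ℕ.+ (b ℕ.∸ 1)) - 1ℚ        ≡⟨ cong (_- 1ℚ) (fromℕ-+ 1 (b ℕ.∸ 1)) ⟩
      1ℚ + fromℕ (b ℕ.∸ 1) - 1ℚ           ≡⟨ solve 1 (λ x → con 1ℚ :+ x :- con 1ℚ := x) refl (fromℕ (b ℕ.∸ 1)) ⟩
      fromℕ (b ℕ.∸ 1)                     ∎
    h≡r : h ≡ r
    h≡r = begin
      (fromℕ b - 1ℚ) * recipℕ (suc n)                     ≡⟨ cong₂ (λ x y → x * recipℕ y) b-1 eq ⟩
      fromℕ (b ℕ.∸ 1) * recipℕ ((b ℕ.∸ 1) ℕ.* q)          ≡⟨ cong (fromℕ (b ℕ.∸ 1) *_) (recipℕ-* (b ℕ.∸ 1) q 1≤b-1 q≥1) ⟩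
      fromℕ (b ℕ.∸ 1) * (recipℕ (b ℕ.∸ 1) * r)            ≡⟨ *-recipℕ (b ℕ.∸ 1) 1≤b-1 r ⟩
      r                                                   ∎
    step : ∀ i → recip (1ℚ + fromℕ (suc i) * h) * h ≡ recipℕ (suc (i ℕ.+ q))
    step i = begin
      recip (1ℚ + s * h) * h    ≡⟨ cong (λ x → recip (1ℚ + s * x) * x) h≡r ⟩
      recip y * r               ≡⟨ recip-unique (0<fromℕ (suc (i ℕ.+ q)) (ℕ.s≤s ℕ.z≤n)) (begin
        fromℕ (suc i ℕ.+ q) * (recip y * r)    ≡⟨ cong (_* (recip y * r)) (fromℕ-+ (suc i) q) ⟩
        (s + fromℕ q) * (recip y * r)          ≡⟨ solve 4 (λ s q y r → (s :+ q) :* (y :* r) := (q :* r :+ s :* r) :* y) refl s (fromℕ q) (recip y) r ⟩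
        (fromℕ q * r + s * r) * recip y        ≡⟨ cong (λ x → (x + s * r) * recip y) (recipℕ-inverse q q≥1) ⟩
        y * recip y                            ≡⟨ recip-inverse 0<y ⟩
        1ℚ                                     ∎) ⟩
      recipℕ (suc (i ℕ.+ q))    ∎
      where
      s = fromℕ (suc i)
      y = 1ℚ + s * r
      0<y : 0ℚ < y
      0<y = <-≤-trans (positive⁻¹ 1ℚ) (p≤p+q (0≤* (0≤fromℕ (suc i)) (0≤recipℕ q q≥1)))

  -- Only special meshes are treated, those whose nodes come from the N-th descendants of the roots;
  -- the tree estimates then apply to the Riemann sum. Arbitrarily fine meshes of this kind suffice,
  -- since the Riemann sums are Cauchy.
  log-bounds : ∀ N → ∃[ n ] (N ℕ.≤ n × lo ≤ riemannSum recip 1ℚ (fromℕ b) n × riemannSum recip 1ℚ (fromℕ b) n ≤ hi)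
  log-bounds N = n , ℕ.s≤s⁻¹ (ℕ.≤-trans (n<b^n N) (ℕ.≤-trans b^N≤ (ℕ.≤-reflexive (sym eq))))
               , subst (lo ≤_) (sym riemann≡) (∑-mono l λ i _ → lower (i ℕ.+ u) (1≤root i))
               , subst (_≤ hi) (sym riemann≡) (∑-mono l λ i _ → upper (i ℕ.+ u) (1≤root i))
    where
    q = u ℕ.* b ℕ.^ N
    q≥1 : 1 ℕ.≤ q
    q≥1 = ℕ.*-mono-≤ u≥1 (b^n≥1 N)
    b^N≤ : b ℕ.^ N ℕ.≤ (b ℕ.∸ 1) ℕ.* q
    b^N≤ = ℕ.≤-trans (ℕ.m≤n*m (b ℕ.^ N) u {{ℕ.>-nonZero u≥1}}) (ℕ.m≤n*m q (b ℕ.∸ 1) {{ℕ.>-nonZero 1≤b-1}})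
    -- `riemannSum` with index n has n + 1 intervals.
    n = ℕ.pred ((b ℕ.∸ 1) ℕ.* q)
    eq : suc n ≡ (b ℕ.∸ 1) ℕ.* q
    eq = ℕ.suc-pred ((b ℕ.∸ 1) ℕ.* q) {{ℕ.>-nonZero (ℕ.*-mono-≤ 1≤b-1 q≥1)}}
    riemann≡ : riemannSum recip 1ℚ (fromℕ b) n ≡ ∑ᵤ (branch^ N (λ m → recipℕ (suc m)))
    riemann≡ = trans (riemannSum-recip n q q≥1 eq)
      (trans (cong (λ x → ∑< x (λ i → recipℕ (suc (i ℕ.+ q)))) (sym (ℕ.*-assoc (b ℕ.∸ 1) u (b ℕ.^ N))))
        (∑-branch^ N l u (λ m → recipℕ (suc m))))
    0≤1 : ∀ m → 0ℚ ≤ 1ℚ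
    0≤1 _ = <⇒≤ (positive⁻¹ 1ℚ)
    G : ℕ → ℚ
    G m = recipℕ (suc m)
    *1 : ∀ r m → r * mean^ N (λ _ → 1ℚ) m ≡ r
    *1 r m = trans (cong (r *_) (mean^-const N m 1ℚ)) (*-identityʳ r)
    lower : ∀ m → 1 ℕ.≤ m → recipℕ (suc m) ≤ branch^ N G m
    lower m 1≤m = subst (_≤ branch^ N G m) (*1 (recipℕ (suc m)) m)
      (branch^-lower 0≤1 {G} (λ m _ → ≤-reflexive (*-identityʳ (G m))) N m 1≤m)
    upper : ∀ m → 1 ℕ.≤ m → branch^ N G m ≤ recipℕ m
    upper m 1≤m = subst (branch^ N G m ≤_) (*1 (recipℕ m) m)
      (branch^-upper 0≤1 {G} (λ m 1≤m → subst (G m ≤_) (sym (*-identityʳ (recipℕ m)))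
        (recipℕ-anti-≤ m (suc m) 1≤m (ℕ.n≤1+n m))) N m 1≤m)
    1≤root : ∀ i → 1 ℕ.≤ i ℕ.+ u
    1≤root i = ℕ.≤-trans u≥1 (ℕ.m≤n+m u i)

  module Series (h I : ℕ → ℚ) (0≤h : ∀ m → 0ℚ ≤ h m) (0≤I : ∀ m → 0ℚ ≤ I m)
                (mean-h : ∀ m → u ℕ.≤ m → mean h m ≡ h m - I m)
                (c : ℚ) (decay : ∀ n m → 1 ℕ.≤ n → u ℕ.≤ m → mean^ n h m ≤ recipℕ n * c) where

    open Potential u h I mean-h

    F : ℕ → ℚ
    F m = recipℕ m * I m

    0≤F : ∀ m → 0ℚ ≤ F m
    0≤F zero    = ≤-reflexive (sym (*-zeroˡ (I 0)))
    0≤F (suc m) = 0≤* (0≤recipℕ (suc m) (ℕ.s≤s ℕ.z≤n)) (0≤I (suc m))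

    -- `Ψ n` collects the terms up to level n, and the added sum estimates everything beyond. The
    -- weight 1 / m of the root overestimates the future, the weight 1 / (m + 1) underestimates it.
    Ψ U V : ℕ → ℚ
    Ψ n = ∑< (u ℕ.* b ℕ.^ n) F
    U n = Ψ n + ∑ᵤ (λ m → recipℕ m * mean^ n h m)
    V n = Ψ n + ∑ᵤ (λ m → recipℕ (suc m) * mean^ n h m)

    private
      u≤root : ∀ i → u ℕ.≤ i ℕ.+ u
      u≤root i = ℕ.m≤n+m u i

      1≤root : ∀ i → 1 ℕ.≤ i ℕ.+ u
      1≤root i = ℕ.≤-trans u≥1 (u≤root i)

      Ψ-suc : ∀ n → Ψ (suc n) ≡ Ψ n + ∑ᵤ (branch^ n F)
      Ψ-suc n = begin
        ∑< (u ℕ.* (b ℕ.* b ℕ.^ n)) F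
          ≡⟨ cong (λ x → ∑< x F) size ⟩
        ∑< (l ℕ.* b ℕ.^ n ℕ.+ u ℕ.* b ℕ.^ n) F
          ≡⟨ ∑-split (u ℕ.* b ℕ.^ n) (l ℕ.* b ℕ.^ n) F ⟩
        Ψ n + ∑< (l ℕ.* b ℕ.^ n) (λ i → F (i ℕ.+ u ℕ.* b ℕ.^ n))
          ≡⟨ cong (_+_ (Ψ n)) (∑-branch^ n l u F) ⟩
        Ψ n + ∑ᵤ (branch^ n F) ∎
        where
        open ≡-Reasoning
        size : u ℕ.* (b ℕ.* b ℕ.^ n) ≡ l ℕ.* b ℕ.^ n ℕ.+ u ℕ.* b ℕ.^ n
        size = trans (sym (ℕ.*-assoc u b (b ℕ.^ n)))
          (trans (cong (ℕ._* b ℕ.^ n) (sym l+u≡u*b)) (ℕ.*-distribʳ-+ (b ℕ.^ n) l u))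

      ∑ᵤ-step : ∀ (r : ℕ → ℚ) n → ∑ᵤ (λ m → r m * mean^ n h m) ≡ ∑ᵤ (λ m → r m * mean^ n I m) + ∑ᵤ (λ m → r m * mean^ (suc n) h m)
      ∑ᵤ-step r n = trans (∑-cong l λ i _ → step (i ℕ.+ u) (u≤root i)) (∑-+ l _ _)
        where
        step : ∀ m → u ℕ.≤ m → r m * mean^ n h m ≡ r m * mean^ n I m + r m * mean^ (suc n) h m
        step m u≤m = trans
          (solve 3 (λ r h i → r :* h := r :* i :+ r :* (h :- i)) refl (r m) (mean^ n h m) (mean^ n I m))
          (cong (λ x → r m * mean^ n I m + r m * x) (sym (mean^-step n m u≤m)))

    -- By `mean^-step`, passing one level removes the mean of `I` from the estimated part and adds
    -- the true terms `branch^ n F` to `Ψ`. The tree estimates say which of the two is larger; with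
    -- the other weight this gives `V-mono`.
    U-anti : ∀ n → U (suc n) ≤ U n
    U-anti n = begin
      Ψ (suc n) + y         ≡⟨ cong (_+ y) (Ψ-suc n) ⟩
      Ψ n + ∑ᵤ (branch^ n F) + y
        ≤⟨ +-monoˡ-≤ y (+-monoʳ-≤ (Ψ n) (∑-mono l λ i _ → branch^-upper 0≤I (λ _ _ → ≤-refl) n (i ℕ.+ u) (1≤root i))) ⟩
      Ψ n + x + y           ≡⟨ +-assoc (Ψ n) x y ⟩
      Ψ n + (x + y)         ≡⟨ cong (_+_ (Ψ n)) (∑ᵤ-step recipℕ n) ⟨
      U n                   ∎
      where
      open ≤-Reasoning
      x = ∑ᵤ (λ m → recipℕ m * mean^ n I m)
      y = ∑ᵤ (λ m → recipℕ m * mean^ (suc n) h m)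

    V-mono : ∀ n → V n ≤ V (suc n)
    V-mono n = begin
      V n                   ≡⟨ cong (_+_ (Ψ n)) (∑ᵤ-step (λ m → recipℕ (suc m)) n) ⟩
      Ψ n + (x + y)         ≡⟨ +-assoc (Ψ n) x y ⟨
      Ψ n + x + y
        ≤⟨ +-monoˡ-≤ y (+-monoʳ-≤ (Ψ n) (∑-mono l λ i _ → branch^-lower 0≤I
             (λ m 1≤m → *-monoʳ-≤ (0≤I m) (recipℕ-anti-≤ m (suc m) 1≤m (ℕ.n≤1+n m))) n (i ℕ.+ u) (1≤root i))) ⟩
      Ψ n + ∑ᵤ (branch^ n F) + y
                            ≡⟨ cong (_+ y) (Ψ-suc n) ⟨
      Ψ (suc n) + y         ∎
      where
      open ≤-Reasoning
      x = ∑ᵤ (λ m → recipℕ (suc m) * mean^ n I m)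
      y = ∑ᵤ (λ m → recipℕ (suc m) * mean^ (suc n) h m)

    U-anti-+ : ∀ j n → U (j ℕ.+ n) ≤ U n
    U-anti-+ zero    n = ≤-refl
    U-anti-+ (suc j) n = ≤-trans (U-anti (j ℕ.+ n)) (U-anti-+ j n)

    V-lower : ∀ n → V 0 ≤ V n
    V-lower zero    = ≤-refl
    V-lower (suc n) = ≤-trans (V-lower n) (V-mono n)

    D : ℚ
    D = ∑ᵤ (λ m → recipℕ m * c)

    remainder : ∀ n → 1 ℕ.≤ n → ∑ᵤ (λ m → recipℕ m * mean^ n h m) ≤ D * recipℕ n
    remainder n 1≤n = begin
      ∑ᵤ (λ m → recipℕ m * mean^ n h m)        ≤⟨ ∑-mono l (λ i _ → *-monoˡ-≤ (0≤recipℕ (i ℕ.+ u) (1≤root i)) (decay n (i ℕ.+ u) 1≤n (u≤root i))) ⟩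
      ∑ᵤ (λ m → recipℕ m * (recipℕ n * c))     ≡⟨ ∑-cong l (λ i _ → solve 3 (λ x y z → x :* (y :* z) := y :* (x :* z)) refl (recipℕ (i ℕ.+ u)) (recipℕ n) c) ⟩
      ∑ᵤ (λ m → recipℕ n * (recipℕ m * c))     ≡⟨ ∑-*ˡ l (recipℕ n) (λ i → recipℕ (i ℕ.+ u) * c) ⟩
      recipℕ n * D                             ≡⟨ *-comm (recipℕ n) D ⟩
      D * recipℕ n                             ∎
      where open ≤-Reasoning

    Ψ≤U : ∀ n → Ψ n ≤ U n
    Ψ≤U n = p≤p+q (∑-nonneg l λ i _ → 0≤* (0≤recipℕ (i ℕ.+ u) (1≤root i)) (mean^-nonneg n (i ℕ.+ u) (λ m _ → 0≤h m)))

    -- Level n + j lies past the first n terms, because n + j < b^(n + j), and it lies at or beyond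
    -- level j, from which `U` has not increased.
    ∑F≤U : ∀ j n → ∑< n F ≤ U j
    ∑F≤U j n = begin
      ∑< n F             ≤⟨ ∑-length-mono 0≤F n≤ ⟩
      Ψ (n ℕ.+ j)        ≤⟨ Ψ≤U (n ℕ.+ j) ⟩
      U (n ℕ.+ j)        ≤⟨ U-anti-+ n j ⟩
      U j                ∎
      where
      open ≤-Reasoning
      n≤ : n ℕ.≤ u ℕ.* b ℕ.^ (n ℕ.+ j)
      n≤ = ℕ.≤-trans (ℕ.≤-trans (ℕ.m≤m+n n j) (ℕ.<⇒≤ (n<b^n (n ℕ.+ j))))
             (ℕ.m≤n*m (b ℕ.^ (n ℕ.+ j)) u {{ℕ.>-nonZero u≥1}})

    -- At a deep level j the lower estimate is at most `U j`, hence exceeds `Ψ j` by no more than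
    -- the remainder, which is O(1 / j).
    lower : ∀ ε → 0ℚ < ε → ∃[ N ] (∀ n → N ℕ.≤ n → V 0 ≤ ∑< n F + ε)
    lower ε 0<ε = let j , 1≤j , small = archimedean D ε 0<ε in
      u ℕ.* b ℕ.^ j , λ n N≤n → begin
        V 0          ≤⟨ V-lower j ⟩
        V j          ≤⟨ +-monoʳ-≤ (Ψ j) (∑-mono l λ i _ → *-monoʳ-≤ (mean^-nonneg j (i ℕ.+ u) (λ m _ → 0≤h m))
                          (recipℕ-anti-≤ (i ℕ.+ u) (suc (i ℕ.+ u)) (1≤root i) (ℕ.n≤1+n (i ℕ.+ u)))) ⟩
        U j          ≤⟨ +-mono-≤ (∑-length-mono 0≤F N≤n) (≤-trans (remainder j 1≤j) small) ⟩
        ∑< n F + ε   ∎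
      where open ≤-Reasoning

    tail : ∀ ε → 0ℚ < ε → ∃[ N ] (∀ n → ∑< n F ≤ ∑< N F + ε)
    tail ε 0<ε = let j , 1≤j , small = archimedean D ε 0<ε in
      u ℕ.* b ℕ.^ j , λ n → ≤-trans (∑F≤U j n) (+-monoʳ-≤ (Ψ j) (≤-trans (remainder j 1≤j) small))

-- Digits and occurrences

module _ {A : Set} {P : A → Set} (P? : Decidable P) where

  dropWhile-++ : ∀ xs ys → dropWhile P? (xs ++ ys) ≡ dropWhile P? (dropWhile P? xs ++ ys)
  dropWhile-++ []       ys = refl
  dropWhile-++ (x ∷ xs) ys with does (P? x) in eq
  ... | true  = dropWhile-++ xs ys
  ... | false rewrite eq = refl

  -- Either nothing survives, or the first survivor shields itself and everything appended later.
  dropWhile-stable : ∀ xs → dropWhile P? xs ≡ [] ⊎ (∀ ys → dropWhile P? (dropWhile P? xs ++ ys) ≡ dropWhile P? xs ++ ys)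
  dropWhile-stable []       = inj₁ refl
  dropWhile-stable (x ∷ xs) with does (P? x) in eq
  ... | true  = dropWhile-stable xs
  ... | false = inj₂ λ ys → drop-none ys
    where
    drop-none : ∀ ys → dropWhile P? (x ∷ xs ++ ys) ≡ x ∷ xs ++ ys
    drop-none ys rewrite eq = refl

  dropWhile-accept : ∀ {x} → P x → dropWhile P? [ x ] ≡ []
  dropWhile-accept {x} px with P? x
  ... | yes _  = refl
  ... | no ¬px = contradiction px ¬px

  dropWhile-reject : ∀ {x} → ¬ P x → dropWhile P? [ x ] ≡ [ x ]
  dropWhile-reject {x} ¬px with P? x
  ... | yes px = contradiction px ¬px
  ... | no _   = refl

bit : Bool → ℕ
bit t = if t then 1 else 0

length-filter-upTo-suc : ∀ {P : ℕ → Set} (P? : Decidable P) n →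
  length (filter P? (upTo (suc n))) ≡ length (filter P? (upTo n)) ℕ.+ bit (does (P? n))
length-filter-upTo-suc P? n = begin
  length (filter P? (upTo (suc n)))                          ≡⟨ cong (length ∘ filter P?) (List.upTo-∷ʳ n) ⟨
  length (filter P? (upTo n ++ [ n ]))                       ≡⟨ cong length (List.filter-++ P? (upTo n) [ n ]) ⟩
  length (filter P? (upTo n) ++ filter P? [ n ])             ≡⟨ List.length-++ (filter P? (upTo n)) ⟩
  length (filter P? (upTo n)) ℕ.+ length (filter P? [ n ])   ≡⟨ cong (length (filter P? (upTo n)) ℕ.+_) last ⟩
  length (filter P? (upTo n)) ℕ.+ bit (does (P? n))          ∎
  where
  open ≡-Reasoning
  last : length (filter P? [ n ]) ≡ bit (does (P? n))
  last with does (P? n)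
  ... | true  = refl
  ... | false = refl

length-filter-upTo-cong : ∀ {P Q : ℕ → Set} (P? : Decidable P) (Q? : Decidable Q) n →
  (∀ i → i ℕ.< n → does (P? i) ≡ does (Q? i)) → length (filter P? (upTo n)) ≡ length (filter Q? (upTo n))
length-filter-upTo-cong P? Q? zero    _   = refl
length-filter-upTo-cong P? Q? (suc n) P≡Q = begin
  length (filter P? (upTo (suc n)))                     ≡⟨ length-filter-upTo-suc P? n ⟩
  length (filter P? (upTo n)) ℕ.+ bit (does (P? n))
    ≡⟨ cong₂ (λ c t → c ℕ.+ bit t) (length-filter-upTo-cong P? Q? n (λ i i<n → P≡Q i (ℕ.m<n⇒m<1+n i<n))) (P≡Q n ℕ.≤-refl) ⟩
  length (filter Q? (upTo n)) ℕ.+ bit (does (Q? n))     ≡⟨ length-filter-upTo-suc Q? n ⟨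
  length (filter Q? (upTo (suc n)))                     ∎
  where open ≡-Reasoning

module _ {A : Set} where

  take-++ : ∀ n (xs ys : List A) → n ℕ.≤ length xs → take n (xs ++ ys) ≡ take n xs
  take-++ zero    xs       ys _   = refl
  take-++ (suc n) (x ∷ xs) ys n≤l = cong (x ∷_) (take-++ n xs ys (ℕ.s≤s⁻¹ n≤l))

  drop-++ : ∀ n (xs ys : List A) → n ℕ.≤ length xs → drop n (xs ++ ys) ≡ drop n xs ++ ys
  drop-++ zero    xs       ys _   = refl
  drop-++ (suc n) (x ∷ xs) ys n≤l = drop-++ n xs ys (ℕ.s≤s⁻¹ n≤l)

  take-drop-++ : ∀ p i (xs ys : List A) → i ℕ.+ p ℕ.≤ length xs → take p (drop i (xs ++ ys)) ≡ take p (drop i xs)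
  take-drop-++ p i xs ys i+p≤l = trans (cong (take p) (drop-++ i xs ys (ℕ.m+n≤o⇒m≤o i i+p≤l)))
    (take-++ p (drop i xs) ys (ℕ.≤-trans (ℕ.m+n≤o⇒m≤o∸n p (subst (ℕ._≤ length xs) (ℕ.+-comm i p) i+p≤l))
      (ℕ.≤-reflexive (sym (List.length-drop i xs)))))

  take-reverse : ∀ p (xs : List A) → p ℕ.≤ length xs →
                 reverse (take p (drop (length xs ℕ.∸ p) xs)) ≡ take p (reverse xs)
  take-reverse p xs p≤l = begin
    reverse (take p ys)                        ≡⟨ cong reverse (List.take-all p ys (ℕ.≤-reflexive ∣ys∣)) ⟩
    reverse ys                                 ≡⟨ List.take-all p (reverse ys) (ℕ.≤-reflexive ∣rys∣) ⟨
    take p (reverse ys)                        ≡⟨ take-++ p (reverse ys) (reverse zs) (ℕ.≤-reflexive (sym ∣rys∣)) ⟨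
    take p (reverse ys ++ reverse zs)          ≡⟨ cong (take p) (List.reverse-++ zs ys) ⟨
    take p (reverse (zs ++ ys))                ≡⟨ cong (take p ∘ reverse) (List.take++drop≡id k xs) ⟩
    take p (reverse xs)                        ∎
    where
    open ≡-Reasoning
    k  = length xs ℕ.∸ p
    ys = drop k xs
    zs = take k xs
    ∣ys∣ : length ys ≡ p
    ∣ys∣ = trans (List.length-drop k xs) (ℕ.m∸[m∸n]≡n p≤l)
    ∣rys∣ : length (reverse ys) ≡ p
    ∣rys∣ = trans (List.length-reverse ys) ∣ys∣

module Digits (b : ℕ) (b≥2 : 2 ℕ.≤ b) where

  open Tree b b≥2

  instance
    nonZero-b : ℕ.NonZero b
    nonZero-b = ℕ.>-nonZero b≥1

  child-% : ∀ d m → d ℕ.< b → (d ℕ.+ m ℕ.* b) ℕ.% b ≡ d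
  child-% d m d<b = trans ([m+kn]%n≡m%n d m b) (m<n⇒m%n≡m d<b)

  child-/ : ∀ d m → d ℕ.< b → (d ℕ.+ m ℕ.* b) ℕ./ b ≡ m
  child-/ d m d<b = trans (+-distrib-/-∣ʳ d (divides-refl m))
    (cong₂ ℕ._+_ (m<n⇒m/n≡0 d<b) (m*n/n≡m m b))

  zero? : (d : Fin b) → Dec (toℕ d ≡ 0)
  zero? d = toℕ d ℕ.≟ 0

  strip : List (Fin b) → List (Fin b)
  strip ds = dropWhile zero? (reverse ds)

  strip-∷ : ∀ d ds → strip (d ∷ ds) ≡ dropWhile zero? (strip ds ++ [ d ])
  strip-∷ d ds = trans (cong (dropWhile zero?) (List.unfold-reverse d ds)) (dropWhile-++ zero? (reverse ds) [ d ])

  strip≡[]⇒0 : ∀ ds → strip ds ≡ [] → fromDigits ds ≡ 0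
  strip≡[]⇒0 []       _  = refl
  strip≡[]⇒0 (d ∷ ds) eq with dropWhile-stable zero? (reverse ds) | trans (sym (strip-∷ d ds)) eq
  ... | inj₂ stable | eq′ = contradiction (List.++-conicalʳ (strip ds) [ d ] (trans (sym (stable [ d ])) eq′)) λ ()
  ... | inj₁ none   | eq′ with zero? d
  ...   | yes d≡0 = cong₂ (λ x y → x ℕ.+ y ℕ.* b) d≡0 (strip≡[]⇒0 ds none)
  ...   | no d≢0  = contradiction (trans (sym (dropWhile-reject zero? d≢0)) (trans (cong (λ xs → dropWhile zero? (xs ++ [ d ])) (sym none)) eq′)) λ ()

  0⇒strip≡[] : ∀ ds → fromDigits ds ≡ 0 → strip ds ≡ []
  0⇒strip≡[] []       _  = refl
  0⇒strip≡[] (d ∷ ds) eq = begin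
    strip (d ∷ ds)                        ≡⟨ strip-∷ d ds ⟩
    dropWhile zero? (strip ds ++ [ d ])   ≡⟨ cong (λ xs → dropWhile zero? (xs ++ [ d ])) (0⇒strip≡[] ds
                                               (ℕ.m*n≡0⇒m≡0 (fromDigits ds) b (ℕ.m+n≡0⇒n≡0 (toℕ d) eq))) ⟩
    dropWhile zero? [ d ]                 ≡⟨ dropWhile-accept zero? (ℕ.m+n≡0⇒m≡0 (toℕ d) eq) ⟩
    []                                    ∎
    where open ≡-Reasoning

  -- The result of `toDigits` is known only through its value, so minimal representations are
  -- handled by this uniqueness: remainder and quotient by b determine the last digit and the rest.
  -- If one list ends first, the other has value 0 and is stripped entirely.
  strip-unique : ∀ ds es → fromDigits ds ≡ fromDigits es → strip ds ≡ strip es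
  strip-unique []       es       eq = sym (0⇒strip≡[] es (sym eq))
  strip-unique (d ∷ ds) []       eq = 0⇒strip≡[] (d ∷ ds) eq
  strip-unique (d ∷ ds) (e ∷ es) eq = begin
    strip (d ∷ ds)                        ≡⟨ strip-∷ d ds ⟩
    dropWhile zero? (strip ds ++ [ d ])   ≡⟨ cong₂ (λ xs x → dropWhile zero? (xs ++ [ x ])) (strip-unique ds es tails) heads ⟩
    dropWhile zero? (strip es ++ [ e ])   ≡⟨ strip-∷ e es ⟨
    strip (e ∷ es)                        ∎
    where
    open ≡-Reasoning
    heads : d ≡ e
    heads = Fin.toℕ-injective (trans (sym (child-% (toℕ d) (fromDigits ds) (Fin.toℕ<n d)))
      (trans (cong (ℕ._% b) eq) (child-% (toℕ e) (fromDigits es) (Fin.toℕ<n e))))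
    tails : fromDigits ds ≡ fromDigits es
    tails = trans (sym (child-/ (toℕ d) (fromDigits ds) (Fin.toℕ<n d)))
      (trans (cong (ℕ._/ b) eq) (child-/ (toℕ e) (fromDigits es) (Fin.toℕ<n e)))

  digits-fromDigits : ∀ ds → digits b≥2 (fromDigits ds) ≡ strip ds
  digits-fromDigits ds = let es , eq = toDigits b {fromWitness b≥2} (fromDigits ds) in strip-unique es ds eq

  digits-0 : digits b≥2 0 ≡ []
  digits-0 = digits-fromDigits []

  -- The hypothesis excludes appending the digit 0 to 0, whose digit string is empty and stays
  -- empty.
  digits-child : ∀ d m → 1 ℕ.≤ toℕ d ℕ.+ m ℕ.* b → digits b≥2 (toℕ d ℕ.+ m ℕ.* b) ≡ digits b≥2 m ++ [ d ]
  digits-child d m 1≤n with toDigits b {fromWitness b≥2} m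
  ... | ds , refl = trans (digits-fromDigits (d ∷ ds)) (trans (strip-∷ d ds) step)
    where
    step : dropWhile zero? (strip ds ++ [ d ]) ≡ strip ds ++ [ d ]
    step with dropWhile-stable zero? (reverse ds)
    ... | inj₂ stable = stable [ d ]
    ... | inj₁ none   = trans (cong (λ xs → dropWhile zero? (xs ++ [ d ])) none)
      (trans (dropWhile-reject zero? λ d≡0 → ℕ.<⇒≢ 1≤n (sym (cong₂ (λ x y → x ℕ.+ y ℕ.* b) d≡0 (strip≡[]⇒0 ds none))))
        (cong (_++ [ d ]) (sym none)))

  lastDigit : ℕ → Fin b
  lastDigit m = Fin.fromℕ< (m%n<n m b)

  toℕ-lastDigit : ∀ m → toℕ (lastDigit m) ≡ m ℕ.% b
  toℕ-lastDigit m = Fin.toℕ-fromℕ< (m%n<n m b)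

  digits-unfold : ∀ m → 1 ℕ.≤ m → digits b≥2 m ≡ digits b≥2 (m ℕ./ b) ++ [ lastDigit m ]
  digits-unfold m 1≤m = trans (cong (digits b≥2) eq) (digits-child (lastDigit m) (m ℕ./ b) (subst (1 ℕ.≤_) eq 1≤m))
    where
    eq : m ≡ toℕ (lastDigit m) ℕ.+ m ℕ./ b ℕ.* b
    eq = trans (m≡m%n+[m/n]*n m b) (cong (ℕ._+ m ℕ./ b ℕ.* b) (sym (toℕ-lastDigit m)))

  length-digits : ∀ m → 1 ℕ.≤ m → length (digits b≥2 m) ≡ suc (length (digits b≥2 (m ℕ./ b)))
  length-digits m 1≤m = trans (cong length (digits-unfold m 1≤m))
    (trans (List.length-++ (digits b≥2 (m ℕ./ b))) (ℕ.+-comm _ 1))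

  length-digits-≤ : ∀ n m → m ℕ.< b ℕ.^ n → length (digits b≥2 m) ℕ.≤ n
  length-digits-≤ n       zero    _    = subst (λ xs → length xs ℕ.≤ n) (sym digits-0) ℕ.z≤n
  length-digits-≤ zero    (suc m) m<1  = contradiction m<1 (ℕ.≤⇒≯ (ℕ.s≤s ℕ.z≤n))
  length-digits-≤ (suc n) (suc m) m<b^ = subst (ℕ._≤ suc n) (sym (length-digits (suc m) (ℕ.s≤s ℕ.z≤n)))
    (ℕ.s≤s (length-digits-≤ n (suc m ℕ./ b) (m<n*o⇒m/o<n (subst (suc m ℕ.<_) (ℕ.*-comm b (b ℕ.^ n)) m<b^))))

  length-digits-> : ∀ n m → b ℕ.^ n ℕ.≤ m → n ℕ.< length (digits b≥2 m)
  length-digits-> zero    m 1≤m   = subst (0 ℕ.<_) (sym (length-digits m 1≤m)) (ℕ.s≤s ℕ.z≤n)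
  length-digits-> (suc n) m b^n≤m = subst (suc n ℕ.<_) (sym (length-digits m (ℕ.≤-trans (b^n≥1 (suc n)) b^n≤m)))
    (ℕ.s≤s (length-digits-> n (m ℕ./ b) (ℕ.≤-trans
      (ℕ.≤-reflexive (sym (m*n/n≡m (b ℕ.^ n) b)))
      (/-monoˡ-≤ b (subst (ℕ._≤ m) (ℕ.*-comm b (b ℕ.^ n)) b^n≤m)))))

  -- Whether the last digits of m, read backwards, start with v.
  match : List (Fin b) → ℕ → Bool
  match []       m = true
  match (x ∷ xs) m = does (m ℕ.% b ℕ.≟ toℕ x) ∧ match xs (m ℕ./ b)

  -- `match` goes on reading zeros beyond the leading digit, so it agrees with a comparison of digit
  -- strings only if m has enough digits.
  match-digits : ∀ v m → length v ℕ.≤ length (digits b≥2 m) →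
                 does (List.≡-dec Fin._≟_ (take (length v) (reverse (digits b≥2 m))) v) ≡ match v m
  match-digits []       m _   = refl
  match-digits (x ∷ xs) zero l≤ = contradiction (subst (λ ds → length (x ∷ xs) ℕ.≤ length ds) digits-0 l≤) λ ()
  match-digits (x ∷ xs) m@(suc _) l≤ = begin
    does (List.≡-dec Fin._≟_ (take (suc (length xs)) (reverse (digits b≥2 m))) (x ∷ xs))
      ≡⟨ cong (λ ds → does (List.≡-dec Fin._≟_ (take (suc (length xs)) ds) (x ∷ xs))) rev ⟩
    does (lastDigit m Fin.≟ x) ∧ does (List.≡-dec Fin._≟_ (take (length xs) (reverse (digits b≥2 (m ℕ./ b)))) xs)
      ≡⟨ cong₂ _∧_ (does-⇔ (mk⇔ (λ eq → trans (sym (toℕ-lastDigit m)) (cong toℕ eq))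
                                 (λ eq → Fin.toℕ-injective (trans (toℕ-lastDigit m) eq))) (lastDigit m Fin.≟ x) (m ℕ.% b ℕ.≟ toℕ x))
           (match-digits xs (m ℕ./ b) (ℕ.s≤s⁻¹ (subst (suc (length xs) ℕ.≤_) (length-digits m (ℕ.s≤s ℕ.z≤n)) l≤))) ⟩
    match (x ∷ xs) m ∎
    where
    open ≡-Reasoning
    rev : reverse (digits b≥2 m) ≡ lastDigit m ∷ reverse (digits b≥2 (m ℕ./ b))
    rev = trans (cong reverse (digits-unfold m (ℕ.s≤s ℕ.z≤n))) (List.reverse-++ (digits b≥2 (m ℕ./ b)) [ lastDigit m ])

  module _ {p : ℕ} (w : Vec (Fin b) p) where

    v : List (Fin b)
    v = reverse (toList w)

    length-v : length v ≡ p
    length-v = trans (List.length-reverse (toList w)) (Vec.length-toList w)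

    count : ℕ → ℕ
    count m = length (occurrences w (digits b≥2 m))

    count-short : ∀ m → suc (length (digits b≥2 m)) ℕ.≤ p → count m ≡ 0
    count-short m l<p = cong (λ n → length (filter (λ i → List.≡-dec Fin._≟_ (take p (drop i (digits b≥2 m))) (toList w)) (upTo n)))
      (ℕ.m≤n⇒m∸n≡0 l<p)

    -- Every window that stops before the last digit is a window of the parent m / b. The only new
    -- one ends at the last digit; read backwards, it is the prefix that `match` tests.
    count-child : ∀ m → 1 ℕ.≤ m → p ℕ.≤ length (digits b≥2 m) → count m ≡ count (m ℕ./ b) ℕ.+ bit (match v m)
    count-child m 1≤m p≤l = begin
      length (filter P? (upTo (suc (length X) ℕ.∸ p)))
        ≡⟨ cong (λ n → length (filter P? (upTo n))) (ℕ.+-∸-assoc 1 p≤l) ⟩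
      length (filter P? (upTo (suc k)))
        ≡⟨ length-filter-upTo-suc P? k ⟩
      length (filter P? (upTo k)) ℕ.+ bit (does (P? k))
        ≡⟨ cong₂ ℕ._+_ (trans (length-filter-upTo-cong P? Q? k earlier) (cong (λ n → length (filter Q? (upTo n))) k≡)) (cong bit last) ⟩
      length (filter Q? (upTo (suc (length Y) ℕ.∸ p))) ℕ.+ bit (match v m) ∎
      where
      open ≡-Reasoning
      X = digits b≥2 m
      Y = digits b≥2 (m ℕ./ b)
      k = length X ℕ.∸ p
      P? = λ i → List.≡-dec Fin._≟_ (take p (drop i X)) (toList w)
      Q? = λ i → List.≡-dec Fin._≟_ (take p (drop i Y)) (toList w)
      k≡ : k ≡ suc (length Y) ℕ.∸ p
      k≡ = cong (ℕ._∸ p) (length-digits m 1≤m)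
      earlier : ∀ i → i ℕ.< k → does (P? i) ≡ does (Q? i)
      earlier i i<k = cong (λ xs → does (List.≡-dec Fin._≟_ xs (toList w)))
        (trans (cong (take p ∘ drop i) (digits-unfold m 1≤m)) (take-drop-++ p i Y _ (ℕ.s≤s⁻¹
          (ℕ.≤-trans (ℕ.m≤o∸n⇒m+n≤o (suc i) p≤l i<k) (ℕ.≤-reflexive (length-digits m 1≤m))))))
      last : does (P? k) ≡ match v m
      last = trans
        (does-⇔ (mk⇔
          (λ eq → trans (cong (λ n → take n (reverse X)) length-v) (trans (sym (take-reverse p X p≤l)) (cong reverse eq)))
          (λ eq → List.reverse-injective (trans (take-reverse p X p≤l) (trans (cong (λ n → take n (reverse X)) (sym length-v)) eq))))
          (P? k) (List.≡-dec Fin._≟_ (take (length v) (reverse X)) v))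
        (match-digits v m (subst (ℕ._≤ length X) (sym length-v) p≤l))

-- The martingale

⟦_⟧ : Bool → ℚ
⟦ t ⟧ = if t then 1ℚ else 0ℚ

0≤⟦_⟧ : ∀ t → 0ℚ ≤ ⟦ t ⟧
0≤⟦ true ⟧  = <⇒≤ (positive⁻¹ 1ℚ)
0≤⟦ false ⟧ = ≤-refl

⟦_⟧≤1 : ∀ t → ⟦ t ⟧ ≤ 1ℚ
⟦ true ⟧≤1  = ≤-refl
⟦ false ⟧≤1 = <⇒≤ (positive⁻¹ 1ℚ)

module _ {A : Set} where

  does-true : (a? : Dec A) → A → does a? ≡ true
  does-true (yes _) _ = refl
  does-true (no ¬a) a = contradiction a ¬a

  does-false : (a? : Dec A) → ¬ A → does a? ≡ false
  does-false (yes a) ¬a = contradiction a ¬a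
  does-false (no _)  _  = refl

  does⁻¹ : (a? : Dec A) → does a? ≡ true → A
  does⁻¹ (yes a) _ = a

module Overlaps (b : ℕ) (b≥2 : 2 ℕ.≤ b) where

  open Tree b b≥2
  open Digits b b≥2

  match-∷ : ∀ y ys m → match (y ∷ ys) m ≡ true → m ℕ.% b ≡ toℕ y × match ys (m ℕ./ b) ≡ true
  match-∷ y ys m eq = does⁻¹ (m ℕ.% b ℕ.≟ toℕ y) (∧-conicalˡ _ _ eq) , ∧-conicalʳ (does (m ℕ.% b ℕ.≟ toℕ y)) _ eq

  match-fromDigits : ∀ v → match v (fromDigits v) ≡ true
  match-fromDigits []       = refl
  match-fromDigits (y ∷ ys) = cong₂ _∧_
    (does-true (fromDigits (y ∷ ys) ℕ.% b ℕ.≟ toℕ y) (child-% (toℕ y) (fromDigits ys) (Fin.toℕ<n y)))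
    (trans (cong (match ys) (child-/ (toℕ y) (fromDigits ys) (Fin.toℕ<n y))) (match-fromDigits ys))

  -- Two numbers ending in the same word share those digits, so no shorter pattern can tell them
  -- apart.
  match-agree : ∀ v s m n → length s ℕ.≤ length v → match v m ≡ true → match v n ≡ true → match s m ≡ match s n
  match-agree v        []       m n _   _  _  = refl
  match-agree (y ∷ ys) (z ∷ zs) m n l≤ vm vn with match-∷ y ys m vm | match-∷ y ys n vn
  ... | m%b , ym | n%b , yn = cong₂ (λ r t → does (r ℕ.≟ toℕ z) ∧ t) (trans m%b (sym n%b))
    (match-agree ys zs (m ℕ./ b) (n ℕ./ b) (ℕ.s≤s⁻¹ l≤) ym yn)

  -- The word is stored reversed, so the nonempty suffixes of the list are its prefixes. Before each digit of m a
  -- gambler arrives and keeps betting everything on the digits of the word in turn; this is their total fortune.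
  fortune : List (Fin b) → ℕ → ℚ
  fortune []       m = 0ℚ
  fortune (y ∷ ys) m = fromℕ (b ℕ.^ suc (length ys)) * ⟦ match (y ∷ ys) m ⟧ + fortune ys m

  fortune-agree : ∀ v s m n → length s ℕ.≤ length v → match v m ≡ true → match v n ≡ true → fortune s m ≡ fortune s n
  fortune-agree v []       m n _  _  _  = refl
  fortune-agree v (y ∷ ys) m n l≤ vm vn = cong₂ (λ t f → fromℕ (b ℕ.^ suc (length ys)) * ⟦ t ⟧ + f)
    (match-agree v (y ∷ ys) m n l≤ vm vn) (fortune-agree v ys m n (ℕ.≤-trans (ℕ.n≤1+n _) l≤) vm vn)

  0≤fortune : ∀ s m → 0ℚ ≤ fortune s m
  0≤fortune []       m = ≤-refl
  0≤fortune (y ∷ ys) m = ≤-trans (0≤* (0≤fromℕ (b ℕ.^ suc (length ys))) 0≤⟦ match (y ∷ ys) m ⟧) (p≤p+q (0≤fortune ys m))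

  -- A geometric series: as b ≥ 2, each power absorbs all lower ones. For the word without its last
  -- digit the bound is b^p, which later keeps the balance nonnegative.
  fortune≤ : ∀ s m → fortune s m ≤ fromℕ (b ℕ.^ suc (length s))
  fortune≤ []       m = 0≤fromℕ (b ℕ.^ 1)
  fortune≤ (y ∷ ys) m = begin
    fromℕ B * ⟦ match (y ∷ ys) m ⟧ + fortune ys m    ≤⟨ +-mono-≤ (*-monoˡ-≤ (0≤fromℕ B) ⟦ match (y ∷ ys) m ⟧≤1) (fortune≤ ys m) ⟩
    fromℕ B * 1ℚ + fromℕ B                           ≡⟨ cong (_+ fromℕ B) (*-identityʳ (fromℕ B)) ⟩
    fromℕ B + fromℕ B                                ≡⟨ fromℕ-+ B B ⟨
    fromℕ (B ℕ.+ B)                                  ≤⟨ fromℕ-mono-≤ 2B≤bB ⟩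
    fromℕ (b ℕ.* B)                                  ∎
    where
    open ≤-Reasoning
    B = b ℕ.^ suc (length ys)
    2B≤bB : B ℕ.+ B ℕ.≤ b ℕ.* B
    2B≤bB = subst (ℕ._≤ b ℕ.* B) (cong (B ℕ.+_) (ℕ.+-identityʳ B)) (ℕ.*-monoˡ-≤ B b≥2)

  -- The bet is fair: exactly one of the b digits wins, and it multiplies the stake by b.
  mean-match : ∀ y ys m → mean (λ c → fromℕ (b ℕ.^ suc (length ys)) * ⟦ match (y ∷ ys) c ⟧) m
                          ≡ fromℕ (b ℕ.^ length ys) * ⟦ match ys m ⟧
  mean-match y ys m = begin
    mean (λ c → fromℕ (b ℕ.* B) * ⟦ match (y ∷ ys) c ⟧) m                ≡⟨ mean-*ˡ m (fromℕ (b ℕ.* B)) (λ c → ⟦ match (y ∷ ys) c ⟧) ⟩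
    fromℕ (b ℕ.* B) * (recipℕ b * branch (λ c → ⟦ match (y ∷ ys) c ⟧) m)  ≡⟨ cong₂ (λ x s → x * (recipℕ b * s)) (fromℕ-* b B) single ⟩
    fromℕ b * fromℕ B * (recipℕ b * t)                                   ≡⟨ solve 4 (λ b B r t → b :* B :* (r :* t) := b :* (r :* (B :* t))) refl (fromℕ b) (fromℕ B) (recipℕ b) t ⟩
    fromℕ b * (recipℕ b * (fromℕ B * t))                                 ≡⟨ *-recipℕ b b≥1 (fromℕ B * t) ⟩
    fromℕ B * t                                                          ∎
    where
    open ≡-Reasoning
    B = b ℕ.^ length ys
    t = ⟦ match ys m ⟧
    single : branch (λ c → ⟦ match (y ∷ ys) c ⟧) m ≡ t
    single = ∑-single b (toℕ y) (Fin.toℕ<n y)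
      (cong ⟦_⟧ (cong₂ _∧_ (does-true ((toℕ y ℕ.+ m ℕ.* b) ℕ.% b ℕ.≟ toℕ y) (child-% (toℕ y) m (Fin.toℕ<n y)))
        (cong (match ys) (child-/ (toℕ y) m (Fin.toℕ<n y)))))
      (λ d d<b d≢y → cong (λ s → ⟦ s ∧ match ys ((d ℕ.+ m ℕ.* b) ℕ./ b) ⟧)
        (does-false ((d ℕ.+ m ℕ.* b) ℕ.% b ℕ.≟ toℕ y) (λ eq → d≢y (trans (sym (child-% d m d<b)) eq))))

  -- All bets are fair and the newcomer brings a stake of 1. The left side still counts a gambler
  -- who has just completed the word; the right side counts only those who are unfinished before the
  -- new digit.
  mean-fortune : ∀ y ys m → mean (fortune (y ∷ ys)) m ≡ fortune ys m + 1ℚ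
  mean-fortune y ys m = begin
    mean (fortune (y ∷ ys)) m
      ≡⟨ mean-+ m (λ c → fromℕ (b ℕ.^ suc (length ys)) * ⟦ match (y ∷ ys) c ⟧) (fortune ys) ⟩
    mean (λ c → fromℕ (b ℕ.^ suc (length ys)) * ⟦ match (y ∷ ys) c ⟧) m + mean (fortune ys) m
      ≡⟨ cong (_+ mean (fortune ys) m) (mean-match y ys m) ⟩
    fromℕ (b ℕ.^ length ys) * ⟦ match ys m ⟧ + mean (fortune ys) m
      ≡⟨ rest ys ⟩
    fortune ys m + 1ℚ ∎
    where
    open ≡-Reasoning
    -- Averaging shortens each pattern by one digit, so the pending term is the head of the next
    -- fortune; for the empty pattern it is the newcomer's stake.
    rest : ∀ ys → fromℕ (b ℕ.^ length ys) * ⟦ match ys m ⟧ + mean (fortune ys) m ≡ fortune ys m + 1ℚ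
    rest []       = cong (_+_ (1ℚ * 1ℚ)) (mean-const m 0ℚ)
    rest (z ∷ zs) = trans (cong (_+_ (fromℕ (b ℕ.^ suc (length zs)) * ⟦ match (z ∷ zs) m ⟧)) (mean-fortune z zs m))
      (sym (+-assoc (fromℕ (b ℕ.^ suc (length zs)) * ⟦ match (z ∷ zs) m ⟧) (fortune zs m) 1ℚ))

  -- Expected waiting times

  module Waiting (x : Fin b) (xs : List (Fin b)) (N : ℕ → ℕ) (m₀ : ℕ)
    (N-child : ∀ d m → d ℕ.< b → m₀ ℕ.≤ m → N (d ℕ.+ m ℕ.* b) ≡ N m ℕ.+ bit (match (x ∷ xs) (d ℕ.+ m ℕ.* b))) where

    -- `f₀` is what the unfinished gamblers hold right after an occurrence of the word. `C` adds the
    -- winner's `B`: it is Conway's leading number, the sum of b^i over the lengths i of the borders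
    -- of the word, the whole word included.
    B f₀ C : ℚ
    B = fromℕ (b ℕ.^ suc (length xs))
    f₀ = fortune xs (fromDigits (x ∷ xs))
    C = B + f₀

    0≤B : 0ℚ ≤ B
    0≤B = 0≤fromℕ (b ℕ.^ suc (length xs))

    fortune-match : ∀ m → match (x ∷ xs) m ≡ true → fortune xs m ≡ f₀
    fortune-match m eq = fortune-agree (x ∷ xs) xs m (fromDigits (x ∷ xs)) (ℕ.n≤1+n _) eq (match-fromDigits (x ∷ xs))

    level exact : ℕ → ℕ → ℚ
    level k m = ⟦ does (N m ℕ.≤? k) ⟧
    exact k m = ⟦ does (N m ℕ.≟ k) ⟧

    -- remaining k m is the expected number of nodes c with N c ≤ k on a random branch starting at m.
    balance remaining : ℕ → ℕ → ℚ
    balance k m   = B * fromℕ k + C - B * fromℕ (N m) - fortune xs m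
    remaining k m = level k m * balance k m

    level-1 : ∀ k m → N m ℕ.≤ k → level k m ≡ 1ℚ
    level-1 k m N≤k = cong ⟦_⟧ (does-true (N m ℕ.≤? k) N≤k)

    level-0 : ∀ k m → k ℕ.< N m → level k m ≡ 0ℚ
    level-0 k m k<N = cong ⟦_⟧ (does-false (N m ℕ.≤? k) (ℕ.<⇒≱ k<N))

    exact-1 : ∀ k m → N m ≡ k → exact k m ≡ 1ℚ
    exact-1 k m N≡k = cong ⟦_⟧ (does-true (N m ℕ.≟ k) N≡k)

    exact-0 : ∀ k m → N m ≢ k → exact k m ≡ 0ℚ
    exact-0 k m N≢k = cong ⟦_⟧ (does-false (N m ℕ.≟ k) N≢k)

    remaining-1 : ∀ k m → N m ℕ.≤ k → remaining k m ≡ balance k m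
    remaining-1 k m N≤k = trans (cong (_* balance k m) (level-1 k m N≤k)) (*-identityˡ (balance k m))

    remaining-0 : ∀ k m → k ℕ.< N m → remaining k m ≡ 0ℚ
    remaining-0 k m k<N = trans (cong (_* balance k m) (level-0 k m k<N)) (*-zeroˡ (balance k m))

    -- `balance k` is built to vanish where the count first becomes k + 1: the unfinished gamblers
    -- then hold `f₀`, which `C` cancels. So the cut-off may be taken at m instead of the child, and
    -- the payout `B` of a match moves into `fortune (x ∷ xs)`, whose mean is known.
    remaining-child : ∀ k d m → d ℕ.< b → m₀ ℕ.≤ m → remaining k (d ℕ.+ m ℕ.* b)
                      ≡ level k m * (B * fromℕ k + C - B * fromℕ (N m) - fortune (x ∷ xs) (d ℕ.+ m ℕ.* b))
    remaining-child k d m d<b m₀≤m = cases (match (x ∷ xs) c) refl (ℕ.<-cmp (N m) k)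
      where
      open ≡-Reasoning
      c = d ℕ.+ m ℕ.* b
      K = fromℕ k
      n = fromℕ (N m)
      N-c : ∀ t → match (x ∷ xs) c ≡ t → N c ≡ N m ℕ.+ bit t
      N-c t eq = trans (N-child d m d<b m₀≤m) (cong (λ s → N m ℕ.+ bit s) eq)
      N-1 : match (x ∷ xs) c ≡ true → N c ≡ suc (N m)
      N-1 eq = trans (N-c true eq) (ℕ.+-comm (N m) 1)
      cases : ∀ t → match (x ∷ xs) c ≡ t → _ → remaining k c ≡ level k m * (B * K + C - B * n - (B * ⟦ match (x ∷ xs) c ⟧ + fortune xs c))
      cases false eq _ = begin
        remaining k c
          ≡⟨ cong (λ N → ⟦ does (N ℕ.≤? k) ⟧ * (B * K + C - B * fromℕ N - fortune xs c)) (trans (N-c false eq) (ℕ.+-identityʳ (N m))) ⟩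
        level k m * (B * K + C - B * n - fortune xs c)
          ≡⟨ cong (_*_ (level k m)) (solve 3 (λ a B f → a :- f := a :- (B :* con 0ℚ :+ f)) refl (B * K + C - B * n) B (fortune xs c)) ⟩
        level k m * (B * K + C - B * n - (B * 0ℚ + fortune xs c))
          ≡⟨ cong (λ t → level k m * (B * K + C - B * n - (B * ⟦ t ⟧ + fortune xs c))) eq ⟨
        level k m * (B * K + C - B * n - (B * ⟦ match (x ∷ xs) c ⟧ + fortune xs c)) ∎
      cases true eq (tri< N<k _ _) = begin
        remaining k c
          ≡⟨ remaining-1 k c (subst (ℕ._≤ k) (sym (N-1 eq)) N<k) ⟩
        B * K + C - B * fromℕ (N c) - fortune xs c
          ≡⟨ cong (λ x → B * K + C - B * x - fortune xs c) (trans (cong fromℕ (N-1 eq)) (fromℕ-+ 1 (N m))) ⟩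
        B * K + C - B * (1ℚ + n) - fortune xs c
          ≡⟨ solve 4 (λ a B n f → a :- B :* (con 1ℚ :+ n) :- f := con 1ℚ :* (a :- B :* n :- (B :* con 1ℚ :+ f))) refl (B * K + C) B n (fortune xs c) ⟩
        1ℚ * (B * K + C - B * n - (B * 1ℚ + fortune xs c))
          ≡⟨ cong₂ (λ j t → j * (B * K + C - B * n - (B * ⟦ t ⟧ + fortune xs c))) (level-1 k m (ℕ.<⇒≤ N<k)) eq ⟨
        level k m * (B * K + C - B * n - (B * ⟦ match (x ∷ xs) c ⟧ + fortune xs c)) ∎
      -- The crossing from k to k + 1: the cut-offs at m and at the child differ, but the bracket
      -- itself is 0.
      cases true eq (tri≈ _ N≡k _) = begin
        remaining k c
          ≡⟨ remaining-0 k c (subst (k ℕ.<_) (sym (N-1 eq)) (ℕ.s≤s (ℕ.≤-reflexive (sym N≡k)))) ⟩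
        0ℚ
          ≡⟨ solve 4 (λ j B K f₀ → con 0ℚ := j :* (B :* K :+ (B :+ f₀) :- B :* K :- (B :* con 1ℚ :+ f₀))) refl (level k m) B K f₀ ⟩
        level k m * (B * K + C - B * K - (B * 1ℚ + f₀))
          ≡⟨ cong₂ (λ x f → level k m * (B * K + C - B * fromℕ x - (B * 1ℚ + f))) N≡k (fortune-match c eq) ⟨
        level k m * (B * K + C - B * n - (B * 1ℚ + fortune xs c))
          ≡⟨ cong (λ t → level k m * (B * K + C - B * n - (B * ⟦ t ⟧ + fortune xs c))) eq ⟨
        level k m * (B * K + C - B * n - (B * ⟦ match (x ∷ xs) c ⟧ + fortune xs c)) ∎
      cases true eq (tri> _ _ k<N) = begin
        remaining k c
          ≡⟨ remaining-0 k c (subst (k ℕ.<_) (sym (N-1 eq)) (ℕ.m<n⇒m<1+n k<N)) ⟩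
        0ℚ
          ≡⟨ *-zeroˡ a ⟨
        0ℚ * a
          ≡⟨ cong (_* a) (level-0 k m k<N) ⟨
        level k m * a ∎
        where a = B * K + C - B * n - (B * ⟦ match (x ∷ xs) c ⟧ + fortune xs c)

    mean-remaining : ∀ k m → m₀ ℕ.≤ m → mean (remaining k) m ≡ remaining k m - level k m
    mean-remaining k m m₀≤m = begin
      mean (remaining k) m
        ≡⟨ cong (recipℕ b *_) (∑-cong b λ d d<b → remaining-child k d m d<b m₀≤m) ⟩
      mean (λ c → level k m * (a - fortune (x ∷ xs) c)) m
        ≡⟨ mean-*ˡ m (level k m) (λ c → a - fortune (x ∷ xs) c) ⟩
      level k m * mean (λ c → a - fortune (x ∷ xs) c) m
        ≡⟨ cong (level k m *_) (mean-- m (λ _ → a) (fortune (x ∷ xs))) ⟩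
      level k m * (mean (λ _ → a) m - mean (fortune (x ∷ xs)) m)
        ≡⟨ cong₂ (λ y z → level k m * (y - z)) (mean-const m a) (mean-fortune x xs m) ⟩
      level k m * (a - (fortune xs m + 1ℚ))
        ≡⟨ solve 3 (λ j a f → j :* (a :- (f :+ con 1ℚ)) := j :* (a :- f) :- j) refl (level k m) a (fortune xs m) ⟩
      remaining k m - level k m ∎
      where
      open ≡-Reasoning
      a = B * fromℕ k + C - B * fromℕ (N m)

    -- The expected number of nodes c with N c = k.
    sojourn : ℕ → ℕ → ℚ
    sojourn zero    m = remaining 0 m
    sojourn (suc k) m = remaining (suc k) m - remaining k m

    mean-sojourn : ∀ k m → m₀ ℕ.≤ m → mean (sojourn k) m ≡ sojourn k m - exact k m
    mean-sojourn zero    m m₀≤m = trans (mean-remaining 0 m m₀≤m) (cong (_-_ (remaining 0 m)) (level≡exact (N m ℕ.≟ 0)))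
      where
      level≡exact : Dec (N m ≡ 0) → level 0 m ≡ exact 0 m
      level≡exact (yes N≡0) = trans (level-1 0 m (ℕ.≤-reflexive N≡0)) (sym (exact-1 0 m N≡0))
      level≡exact (no N≢0)  = trans (level-0 0 m (ℕ.n≢0⇒n>0 N≢0)) (sym (exact-0 0 m N≢0))
    mean-sojourn (suc k) m m₀≤m = begin
      mean (sojourn (suc k)) m
        ≡⟨ mean-- m (remaining (suc k)) (remaining k) ⟩
      mean (remaining (suc k)) m - mean (remaining k) m
        ≡⟨ cong₂ _-_ (mean-remaining (suc k) m m₀≤m) (mean-remaining k m m₀≤m) ⟩
      remaining (suc k) m - level (suc k) m - (remaining k m - level k m)
        ≡⟨ cong (λ j → remaining (suc k) m - j - (remaining k m - level k m)) (split (ℕ.<-cmp (N m) (suc k))) ⟩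
      remaining (suc k) m - (exact (suc k) m + level k m) - (remaining k m - level k m)
        ≡⟨ solve 4 (λ r s e j → r :- (e :+ j) :- (s :- j) := r :- s :- e) refl (remaining (suc k) m) (remaining k m) (exact (suc k) m) (level k m) ⟩
      sojourn (suc k) m - exact (suc k) m ∎
      where
      open ≡-Reasoning
      split : _ → level (suc k) m ≡ exact (suc k) m + level k m
      split (tri< N<1+k N≢1+k _) = trans (level-1 (suc k) m (ℕ.<⇒≤ N<1+k))
        (sym (cong₂ _+_ (exact-0 (suc k) m N≢1+k) (level-1 k m (ℕ.s≤s⁻¹ N<1+k))))
      split (tri≈ _ N≡1+k _) = trans (level-1 (suc k) m (ℕ.≤-reflexive N≡1+k))
        (sym (cong₂ _+_ (exact-1 (suc k) m N≡1+k) (level-0 k m (ℕ.≤-reflexive (sym N≡1+k)))))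
      split (tri> _ N≢1+k 1+k<N) = trans (level-0 (suc k) m 1+k<N)
        (sym (cong₂ _+_ (exact-0 (suc k) m N≢1+k) (level-0 k m (ℕ.<⇒≤ 1+k<N))))

    0≤remaining : ∀ k m → 0ℚ ≤ remaining k m
    0≤remaining k m with ℕ.≤-<-connex (N m) k
    ... | inj₂ k<N = ≤-reflexive (sym (remaining-0 k m k<N))
    ... | inj₁ N≤k = subst (0ℚ ≤_) (sym (trans (remaining-1 k m N≤k)
      (solve 5 (λ B k f₀ n f → B :* k :+ (B :+ f₀) :- B :* n :- f := B :* (k :- n) :+ ((B :- f) :+ f₀)) refl B (fromℕ k) f₀ (fromℕ (N m)) (fortune xs m))))
      (+-mono-≤ (0≤* 0≤B (0≤q-p (fromℕ-mono-≤ N≤k))) (+-mono-≤ (0≤q-p (fortune≤ xs m)) (0≤fortune xs (fromDigits (x ∷ xs)))))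

    -- Count and fortune enter both balances in the same way and cancel; allowing one more
    -- occurrence adds `B` wherever the branch starts.
    sojourn-before : ∀ k m → N m ℕ.≤ k → sojourn (suc k) m ≡ B
    sojourn-before k m N≤k = begin
      remaining (suc k) m - remaining k m
        ≡⟨ cong₂ _-_ (remaining-1 (suc k) m (ℕ.m≤n⇒m≤1+n N≤k)) (remaining-1 k m N≤k) ⟩
      B * fromℕ (suc k) + C - n - f - (B * fromℕ k + C - n - f)
        ≡⟨ cong (λ y → B * y + C - n - f - (B * fromℕ k + C - n - f)) (fromℕ-+ 1 k) ⟩
      B * (1ℚ + fromℕ k) + C - n - f - (B * fromℕ k + C - n - f)
        ≡⟨ solve 5 (λ B k C n f → B :* (con 1ℚ :+ k) :+ C :- n :- f :- (B :* k :+ C :- n :- f) := B) refl B (fromℕ k) C n f ⟩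
      B ∎
      where
      open ≡-Reasoning
      n = B * fromℕ (N m)
      f = fortune xs m

    -- Here `remaining k` is already 0, and the match forces the fortune to be `f₀`, exactly what
    -- `C` holds beyond `B`.
    sojourn-entry : ∀ k m → N m ≡ suc k → match (x ∷ xs) m ≡ true → sojourn (suc k) m ≡ B
    sojourn-entry k m N≡1+k eq = begin
      remaining (suc k) m - remaining k m
        ≡⟨ cong₂ _-_ (remaining-1 (suc k) m (ℕ.≤-reflexive N≡1+k)) (remaining-0 k m (ℕ.≤-reflexive (sym N≡1+k))) ⟩
      B * fromℕ (suc k) + C - B * fromℕ (N m) - fortune xs m - 0ℚ
        ≡⟨ cong₂ (λ n f → B * fromℕ (suc k) + C - B * fromℕ n - f - 0ℚ) N≡1+k (fortune-match m eq) ⟩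
      B * fromℕ (suc k) + C - B * fromℕ (suc k) - f₀ - 0ℚ
        ≡⟨ solve 3 (λ B k f₀ → B :* k :+ (B :+ f₀) :- B :* k :- f₀ :- con 0ℚ := B) refl B (fromℕ (suc k)) f₀ ⟩
      B ∎
      where open ≡-Reasoning

    0≤sojourn : ∀ k m → 0ℚ ≤ sojourn k m
    0≤sojourn zero    m = 0≤remaining 0 m
    0≤sojourn (suc k) m with ℕ.≤-<-connex (N m) k
    ... | inj₁ N≤k = subst (0ℚ ≤_) (sym (sojourn-before k m N≤k)) 0≤B
    ... | inj₂ k<N = 0≤q-p (subst (_≤ remaining (suc k) m) (sym (remaining-0 k m k<N)) (0≤remaining (suc k) m))

    total : ℕ → ℚ
    total k = B * fromℕ k + C

    0≤total : ∀ k → 0ℚ ≤ total k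
    0≤total k = +-mono-≤ (0≤* 0≤B (0≤fromℕ k)) (+-mono-≤ 0≤B (0≤fortune xs (fromDigits (x ∷ xs))))

    remaining≤ : ∀ k m → remaining k m ≤ total k * level k m
    remaining≤ k m = subst (_≤ total k * level k m) (*-comm (balance k m) (level k m))
      (*-monoʳ-≤ {level k m} {balance k m} {total k} 0≤⟦ does (N m ℕ.≤? k) ⟧ (≤-trans
        (p-q≤p (0≤fortune xs m)) (p-q≤p (0≤* 0≤B (0≤fromℕ (N m))))))

    sojourn≤ : ∀ k m → sojourn k m ≤ total k * level k m
    sojourn≤ zero    m = remaining≤ 0 m
    sojourn≤ (suc k) m = ≤-trans (p-q≤p (0≤remaining k m)) (remaining≤ (suc k) m)

    level-anti : ∀ k m → m₀ ℕ.≤ m → ∀ d → d ℕ.< b → level k (d ℕ.+ m ℕ.* b) ≤ level k m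
    level-anti k m m₀≤m d d<b with ℕ.≤-<-connex (N m) k
    ... | inj₁ N≤k = subst (level k (d ℕ.+ m ℕ.* b) ≤_) (sym (level-1 k m N≤k)) ⟦ does (N (d ℕ.+ m ℕ.* b) ℕ.≤? k) ⟧≤1
    ... | inj₂ k<N = ≤-reflexive (trans (level-0 k (d ℕ.+ m ℕ.* b) (ℕ.<-≤-trans k<N
      (subst (N m ℕ.≤_) (sym (N-child d m d<b m₀≤m)) (ℕ.m≤m+n (N m) (bit (match (x ∷ xs) (d ℕ.+ m ℕ.* b))))))) (sym (level-0 k m k<N)))

    -- `mean^-decay` needs an indicator that decreases along branches. `exact` can rise from 0 to 1,
    -- so the argument runs through `level`: one factor `total k` bounds `sojourn` by `level`, the
    -- other bounds the expected time spent with at most k occurrences.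
    sojourn-decay : ∀ k n m → 1 ℕ.≤ n → m₀ ℕ.≤ m → mean^ n (sojourn k) m ≤ recipℕ n * (total k * total k)
    sojourn-decay k n m 1≤n m₀≤m = begin
      mean^ n (sojourn k) m                     ≤⟨ mean^-mono n m (λ c _ → sojourn≤ k c) ⟩
      mean^ n (λ c → total k * level k c) m     ≡⟨ mean^-*ˡ n m (total k) (level k) ⟩
      total k * y                               ≡⟨ cong (total k *_) (*-recipℕ n 1≤n y) ⟨
      total k * (fromℕ n * (recipℕ n * y))      ≡⟨ solve 4 (λ t n r y → t :* (n :* (r :* y)) := r :* (t :* (n :* y))) refl (total k) (fromℕ n) (recipℕ n) y ⟩
      recipℕ n * (total k * (fromℕ n * y))      ≤⟨ *-monoˡ-≤ (0≤recipℕ n 1≤n) (*-monoˡ-≤ (0≤total k) bound) ⟩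
      recipℕ n * (total k * total k)            ∎
      where
      open ≤-Reasoning
      open Potential m₀ (remaining k) (level k) (mean-remaining k)
      y = mean^ n (level k) m
      bound : fromℕ n * y ≤ total k
      bound = ≤-trans (mean^-decay (0≤remaining k) (level-anti k) n m m₀≤m)
        (≤-trans (remaining≤ k m) (subst (total k * level k m ≤_) (*-identityʳ (total k))
          (*-monoˡ-≤ (0≤total k) ⟦ does (N m ℕ.≤? k) ⟧≤1)))

-- Conclusion

module _ (b : ℕ) (b≥2 : 2 ℕ.≤ b) where

  open Tree b b≥2 using (b≥1; b^n≥1)

  recipℕ-^≤^ℤ : ∀ j z → ℤ.- (+ j) ℤ.≤ z → recipℕ (b ℕ.^ j) ≤ fromℕ b ^ℤ z
  recipℕ-^≤^ℤ j (+ n) _ = ≤-trans (recipℕ-anti-≤ 1 (b ℕ.^ j) ℕ.≤-refl (b^n≥1 j))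
    (subst (1ℚ ≤_) (sym (fromℕ-^ b n)) (fromℕ-mono-≤ {1} (b^n≥1 n)))
  recipℕ-^≤^ℤ zero    -[1+ n ] ()
  recipℕ-^≤^ℤ (suc j) -[1+ n ] (ℤ.-≤- n≤j) = subst (recipℕ (b ℕ.^ suc j) ≤_) (cong recip (sym (fromℕ-^ b (suc n))))
    (recipℕ-anti-≤ (b ℕ.^ suc n) (b ℕ.^ suc j) (b^n≥1 (suc n)) (ℕ.^-monoʳ-≤ b {{ℕ.>-nonZero b≥1}} (ℕ.s≤s n≤j)))

-- With k = j + 1, the gap between the two bounds has exponent 1 - k = -j. The stated exponent
-- exceeds it by `d`, which is p for k ≥ 2 and p - 1 for k = 1.
-j≤exponent : ∀ p j → 1 ℕ.≤ p → ℤ.- (+ j) ℤ.≤ + p ℤ.- + (suc j ℕ.⊔ 2) ℤ.+ + 1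
-j≤exponent p j 1≤p = subst (ℤ.- (+ j) ℤ.≤_) eq (ℤ.i≤i+j (ℤ.- (+ j)) (+ d))
  where
  open ≡-Reasoning
  module S = ℤ-Solver.+-*-Solver
  x = suc j ℕ.⊔ 2
  x≤ : x ℕ.≤ p ℕ.+ suc j
  x≤ = ℕ.⊔-lub (ℕ.m≤n+m (suc j) p) (ℕ.+-mono-≤ 1≤p (ℕ.s≤s ℕ.z≤n))
  d = p ℕ.+ suc j ℕ.∸ x
  eq : ℤ.- (+ j) ℤ.+ + d ≡ + p ℤ.- + x ℤ.+ + 1
  eq = begin
    ℤ.- (+ j) ℤ.+ + d
      ≡⟨ S.solve 3 (λ j d x → S.:- j S.:+ d S.:= d S.:+ x S.:- x S.:- j) refl (+ j) (+ d) (+ x) ⟩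
    + (d ℕ.+ x) ℤ.- + x ℤ.- + j
      ≡⟨ cong (λ n → + n ℤ.- + x ℤ.- + j) (ℕ.m∸n+n≡m x≤) ⟩
    + p ℤ.+ (+ 1 ℤ.+ + j) ℤ.- + x ℤ.- + j
      ≡⟨ S.solve 3 (λ p j x → p S.:+ (S.con (+ 1) S.:+ j) S.:- x S.:- j S.:= p S.:- x S.:+ S.con (+ 1)) refl (+ p) (+ j) (+ x) ⟩
    + p ℤ.- + x ℤ.+ + 1 ∎

module Word (b : ℕ) (b≥2 : 2 ℕ.≤ b) (p : ℕ) (1≤p : 1 ℕ.≤ p) (w : Vec (Fin b) p)
  (x : Fin b) (xs : List (Fin b)) (v≡ : Digits.v b b≥2 w ≡ x ∷ xs) where

  open Tree b b≥2
  open Digits b b≥2 hiding (v; count)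
  open Overlaps b b≥2

  N : ℕ → ℕ
  N = Digits.count b b≥2 w

  q : ℕ
  q = p ℕ.∸ 1

  1+q≡p : suc q ≡ p
  1+q≡p = ℕ.m+[n∸m]≡n 1≤p

  N-unfold : ∀ m → 1 ℕ.≤ m → p ℕ.≤ length (digits b≥2 m) → N m ≡ N (m ℕ./ b) ℕ.+ bit (match (x ∷ xs) m)
  N-unfold m 1≤m p≤l = trans (count-child w m 1≤m p≤l) (cong (λ v → N (m ℕ./ b) ℕ.+ bit (match v m)) v≡)

  p≤length : ∀ m → b ℕ.^ q ℕ.≤ m → p ℕ.≤ length (digits b≥2 m)
  p≤length m b^q≤m = subst (ℕ._≤ length (digits b≥2 m)) 1+q≡p (length-digits-> q m b^q≤m)

  N-child : ∀ d m → d ℕ.< b → b ℕ.^ q ℕ.≤ m → N (d ℕ.+ m ℕ.* b) ≡ N m ℕ.+ bit (match (x ∷ xs) (d ℕ.+ m ℕ.* b))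
  N-child d m d<b b^q≤m = trans (N-unfold c (ℕ.≤-trans (b^n≥1 q) b^q≤c) (p≤length c b^q≤c))
    (cong (λ n → N n ℕ.+ bit (match (x ∷ xs) c)) (child-/ d m d<b))
    where
    c = d ℕ.+ m ℕ.* b
    b^q≤c = ℕ.≤-trans b^q≤m (m≤child d m)

  parent< : ∀ n m → m ℕ.< b ℕ.^ suc n → m ℕ./ b ℕ.< b ℕ.^ n
  parent< n m m<b^ = m<n*o⇒m/o<n (subst (m ℕ.<_) (ℕ.*-comm b (b ℕ.^ n)) m<b^)

  bit≤1 : ∀ t → bit t ℕ.≤ 1
  bit≤1 true  = ℕ.≤-refl
  bit≤1 false = ℕ.z≤n

  -- An occurrence needs p = q + 1 digits, and each digit after the first q ends at most one.
  N≤ : ∀ j m → m ℕ.< b ℕ.^ (j ℕ.+ q) → N m ℕ.≤ j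
  N≤ zero    m m<b^ = ℕ.≤-reflexive (count-short w m (subst (suc (length (digits b≥2 m)) ℕ.≤_) 1+q≡p
    (ℕ.s≤s (length-digits-≤ q m m<b^))))
  N≤ (suc j) m m<b^ with p ℕ.≤? length (digits b≥2 m)
  ... | no p≰l = subst (ℕ._≤ suc j) (sym (count-short w m (ℕ.≰⇒> p≰l))) ℕ.z≤n
  N≤ (suc j) zero m<b^ | yes p≤l = contradiction (subst (λ ds → p ℕ.≤ length ds) digits-0 p≤l) (ℕ.<⇒≱ 1≤p)
  N≤ (suc j) m@(suc _) m<b^ | yes p≤l = subst (ℕ._≤ suc j) (sym (trans (N-unfold m (ℕ.s≤s ℕ.z≤n) p≤l) (ℕ.+-comm (N (m ℕ./ b)) _)))
    (ℕ.+-mono-≤ (bit≤1 (match (x ∷ xs) m)) (N≤ j (m ℕ./ b) (parent< (j ℕ.+ q) m m<b^)))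

  open Waiting x xs N (b ℕ.^ q) N-child

  -- The parent has only j + q digits, hence at most j occurrences. So the count j + 1 is reached
  -- only if the last digit completes an occurrence.
  sojourn-root : ∀ j m → b ℕ.^ (j ℕ.+ q) ℕ.≤ m → m ℕ.< b ℕ.^ suc (j ℕ.+ q) → sojourn (suc j) m ≡ B
  sojourn-root j m b^≤m m<b^ = cases (match (x ∷ xs) m) refl
    where
    b^q≤m : b ℕ.^ q ℕ.≤ m
    b^q≤m = ℕ.≤-trans (ℕ.^-monoʳ-≤ b (ℕ.m≤n+m q j)) b^≤m
    N-m : ∀ t → match (x ∷ xs) m ≡ t → N m ≡ bit t ℕ.+ N (m ℕ./ b)
    N-m t eq = trans (N-unfold m (ℕ.≤-trans (b^n≥1 q) b^q≤m) (p≤length m b^q≤m))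
      (trans (cong (λ t → N (m ℕ./ b) ℕ.+ bit t) eq) (ℕ.+-comm (N (m ℕ./ b)) (bit t)))
    N-parent : N (m ℕ./ b) ℕ.≤ j
    N-parent = N≤ j (m ℕ./ b) (parent< (j ℕ.+ q) m m<b^)
    cases : ∀ t → match (x ∷ xs) m ≡ t → sojourn (suc j) m ≡ B
    cases false eq = sojourn-before j m (subst (ℕ._≤ j) (sym (N-m false eq)) N-parent)
    cases true  eq with ℕ.m≤n⇒m<n∨m≡n N-parent
    ... | inj₁ N<j = sojourn-before j m (subst (ℕ._≤ j) (sym (N-m true eq)) N<j)
    ... | inj₂ N≡j = sojourn-entry j m (trans (N-m true eq) (cong suc N≡j)) eq

  -- A number with k + p - 1 digits is at least b^(k + p - 2). For k = 0 the truncated subtraction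
  -- gives `q`, which still lies in the range of `N-child`; only convergence is claimed there.
  height : ℕ → ℕ
  height k = (k ℕ.∸ 1) ℕ.+ q

  module Sum (k : ℕ) where

    u : ℕ
    u = b ℕ.^ height k

    u≥1 : 1 ℕ.≤ u
    u≥1 = b^n≥1 (height k)

    b^q≤u : b ℕ.^ q ℕ.≤ u
    b^q≤u = ℕ.^-monoʳ-≤ b (ℕ.m≤n+m q (k ℕ.∸ 1))

    open Level b b≥2 u u≥1 public
    open Series (sojourn k) (exact k) (0≤sojourn k) (λ m → 0≤⟦ does (N m ℕ.≟ k) ⟧)
      (λ m u≤m → mean-sojourn k m (ℕ.≤-trans b^q≤u u≤m)) (total k * total k)
      (λ n m 1≤n u≤m → sojourn-decay k n m 1≤n (ℕ.≤-trans b^q≤u u≤m)) public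

    term≡F : ∀ i → term b≥2 w k i ≡ F (suc i)
    term≡F i = if≡ (does (N (suc i) ℕ.≟ k))
      where
      if≡ : ∀ t → (if t then + 1 / suc i else 0ℚ) ≡ recipℕ (suc i) * ⟦ t ⟧
      if≡ true  = trans (1/suc≡recipℕ i) (sym (*-identityʳ (recipℕ (suc i))))
      if≡ false = sym (*-zeroʳ (recipℕ (suc i)))

    ∑term≡∑F : ∀ n → ∑< n (term b≥2 w k) ≡ ∑< (suc n) F
    ∑term≡∑F n = begin
      ∑< n (term b≥2 w k)            ≡⟨ ∑-cong n (λ i _ → term≡F i) ⟩
      ∑< n (λ i → F (suc i))         ≡⟨ +-identityˡ _ ⟨
      -- The total reciprocal of 0 is 0, so including m = 0 changes nothing.
      0ℚ + ∑< n (λ i → F (suc i))    ≡⟨ cong (_+ ∑< n (λ i → F (suc i))) (*-zeroˡ (exact k 0)) ⟨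
      F 0 + ∑< n (λ i → F (suc i))   ≡⟨ ∑-suc n F ⟨
      ∑< (suc n) F                   ∎
      where open ≡-Reasoning

    cauchy-term : Cauchy (λ n → ∑< n (term b≥2 w k))
    cauchy-term = ∑-partial-cauchy (term b≥2 w k) (λ i → subst (0ℚ ≤_) (sym (term≡F i)) (0≤F (suc i)))
      λ ε 0<ε → let M , bound = tail ε 0<ε in
        M , λ n → subst₂ (λ y z → y ≤ z + ε) (sym (∑term≡∑F n)) (sym (∑term≡∑F M))
          (≤-trans (bound (suc n)) (+-monoˡ-≤ ε (∑-length-mono 0≤F (ℕ.n≤1+n M))))

  S : ℕ → ℝ
  S k = mkℝ (λ n → ∑< n (term b≥2 w k)) (Sum.cauchy-term k)

  module _ (j : ℕ) where

    open Sum (suc j)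

    Ψ-0 : Ψ 0 ≡ 0ℚ
    Ψ-0 = ∑-zero (u ℕ.* 1) λ m m<u → trans
      (cong (recipℕ m *_) (exact-0 (suc j) m (ℕ.<⇒≢ (ℕ.s≤s (N≤ j m (subst (m ℕ.<_) (ℕ.*-identityʳ u) m<u))))))
      (*-zeroʳ (recipℕ m))

    -- With the weights 1 / m and 1 / (m + 1) this evaluates `U 0` as `B * hi` and `V 0` as
    -- `B * lo`.
    root-sum : ∀ r → Ψ 0 + ∑ᵤ (λ m → r m * sojourn (suc j) m) ≡ B * ∑ᵤ r
    root-sum r = begin
      Ψ 0 + ∑ᵤ (λ m → r m * sojourn (suc j) m)   ≡⟨ cong (_+ ∑ᵤ (λ m → r m * sojourn (suc j) m)) Ψ-0 ⟩
      0ℚ + ∑ᵤ (λ m → r m * sojourn (suc j) m)    ≡⟨ +-identityˡ (∑ᵤ (λ m → r m * sojourn (suc j) m)) ⟩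
      ∑ᵤ (λ m → r m * sojourn (suc j) m)
        ≡⟨ ∑-cong l (λ i i<l → trans (cong (r (i ℕ.+ u) *_) (sojourn-root j (i ℕ.+ u) (ℕ.m≤n+m u i)
             (subst (i ℕ.+ u ℕ.<_) (trans l+u≡u*b (ℕ.*-comm u b)) (ℕ.+-monoˡ-< u i<l)))) (*-comm (r (i ℕ.+ u)) B)) ⟩
      ∑< l (λ i → B * r (i ℕ.+ u))               ≡⟨ ∑-*ˡ l B (λ i → r (i ℕ.+ u)) ⟩
      B * ∑ᵤ r                                   ∎
      where open ≡-Reasoning

    B≡b^p : B ≡ fromℕ b ^ p
    B≡b^p = trans (cong (λ n → fromℕ (b ℕ.^ n)) (trans (sym (cong length v≡)) (length-v w))) (sym (fromℕ-^ b p))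

    bound : ℚ
    bound = (fromℕ b - 1ℚ) * fromℕ b ^ℤ (+ p ℤ.- + (suc j ℕ.⊔ 2) ℤ.+ + 1)

    -- As u = b^(j + p - 1), the product u * b is b^p * b^j; multiplying the gap by `B` cancels b^p
    -- and leaves (b - 1) / b^j.
    B*hi≤ : B * hi ≤ B * lo + bound
    B*hi≤ = begin
      B * hi
        ≡⟨ cong (B *_) hi≡lo+gap ⟩
      B * (lo + (fromℕ b - 1ℚ) * recipℕ (u ℕ.* b))
        ≡⟨ solve 4 (λ B l c r → B :* (l :+ c :* r) := B :* l :+ c :* (B :* r)) refl B lo (fromℕ b - 1ℚ) (recipℕ (u ℕ.* b)) ⟩
      B * lo + (fromℕ b - 1ℚ) * (B * recipℕ (u ℕ.* b))
        ≡⟨ cong (λ y → B * lo + (fromℕ b - 1ℚ) * y) B*recip ⟩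
      B * lo + (fromℕ b - 1ℚ) * recipℕ (b ℕ.^ j)
        ≤⟨ +-monoʳ-≤ (B * lo) (*-monoˡ-≤ (0≤q-p (1≤fromℕ b≥2)) (recipℕ-^≤^ℤ b b≥2 j _ (-j≤exponent p j 1≤p))) ⟩
      B * lo + bound ∎
      where
      open ≤-Reasoning
      size : u ℕ.* b ≡ b ℕ.^ suc (length xs) ℕ.* b ℕ.^ j
      size = trans (ℕ.*-comm u b) (trans (cong (b ℕ.^_)
        (trans (sym (ℕ.+-suc j q)) (trans (ℕ.+-comm j (suc q)) (cong (ℕ._+ j)
          (trans 1+q≡p (sym (trans (sym (cong length v≡)) (length-v w))))))))
        (ℕ.^-distribˡ-+-* b (suc (length xs)) j))
      B*recip : B * recipℕ (u ℕ.* b) ≡ recipℕ (b ℕ.^ j)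
      B*recip = trans (cong (λ n → B * recipℕ n) size)
        (trans (cong (B *_) (recipℕ-* (b ℕ.^ suc (length xs)) (b ℕ.^ j) (b^n≥1 (suc (length xs))) (b^n≥1 j)))
          (*-recipℕ (b ℕ.^ suc (length xs)) (b^n≥1 (suc (length xs))) (recipℕ (b ℕ.^ j))))

    S-close : ∣ S (suc j) -ᴿ (fromℕ b ^ p) · log (fromℕ b) (1≤fromℕ b≥2) ∣ᴿ ≤ᴿ fromℚ bound
    S-close ε 0<ε = M₁ ℕ.⊔ M₂ , λ n M≤n →
      subst (λ c → ∣ ∑< n (term b≥2 w (suc j)) - c * L n ∣ ≤ bound + ε) B≡b^p
        (close n (ℕ.≤-trans (ℕ.m≤m⊔n M₁ M₂) M≤n) (ℕ.≤-trans (ℕ.m≤n⊔m M₁ M₂) M≤n))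
      where
      L : ℕ → ℚ
      L = seq (log (fromℕ b) (1≤fromℕ b≥2))
      η = ½ * ε
      0<η : 0ℚ < η
      0<η = 0<* (positive⁻¹ ½) 0<ε
      b^p≥1 = b^n≥1 (suc (length xs))
      -- This is η / B, so that an error δ in the logarithm becomes η after scaling by `B`.
      δ = recipℕ (b ℕ.^ suc (length xs)) * η
      0<δ : 0ℚ < δ
      0<δ = 0<* (0<recip (0<fromℕ _ b^p≥1)) 0<η
      η+η : η + η ≡ ε
      η+η = solve 1 (λ e → con ½ :* e :+ con ½ :* e := e) refl ε
      lower-η = lower η 0<η
      cauchy-δ = cauchy (log (fromℕ b) (1≤fromℕ b≥2)) δ 0<δ
      M₁ = proj₁ lower-η
      M₂ = proj₁ cauchy-δ

      scaled : ∀ {y z} → y ≤ z + δ → B * y ≤ B * z + η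
      scaled {y} {z} y≤z+δ = subst (B * y ≤_)
        (trans (*-distribˡ-+ B z δ) (cong (_+_ (B * z)) (*-recipℕ (b ℕ.^ suc (length xs)) b^p≥1 η)))
        (*-monoˡ-≤ 0≤B y≤z+δ)

      -- `log-bounds` speaks only of aligned meshes; the Cauchy property carries its bounds from
      -- such an n′ to every n beyond `M₂`, at the cost of δ.
      log-between : ∀ n → M₂ ℕ.≤ n → B * lo ≤ B * L n + η × B * L n ≤ B * hi + η
      log-between n M₂≤n = let n′ , M₂≤n′ , lo≤ , ≤hi = log-bounds M₂ in
          scaled (≤-trans lo≤ (p-q≤r⇒p≤q+r (≤-trans (p≤∣p∣ _) (proj₂ cauchy-δ n′ n M₂≤n′ M₂≤n))))
        , scaled (≤-trans (p-q≤r⇒p≤q+r (≤-trans (p≤∣p∣ _) (proj₂ cauchy-δ n n′ M₂≤n M₂≤n′))) (+-monoˡ-≤ δ ≤hi))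

      close : ∀ n → M₁ ℕ.≤ n → M₂ ℕ.≤ n → ∣ ∑< n (term b≥2 w (suc j)) - B * L n ∣ ≤ bound + ε
      close n M₁≤n M₂≤n = ∣p-q∣≤
        (begin
          T                           ≡⟨ ∑term≡∑F n ⟩
          ∑< (suc n) F                ≤⟨ ∑F≤U 0 (suc n) ⟩
          U 0                         ≡⟨ root-sum recipℕ ⟩
          B * hi                      ≤⟨ B*hi≤ ⟩
          B * lo + bound              ≤⟨ +-monoˡ-≤ bound (proj₁ (log-between n M₂≤n)) ⟩
          B * L n + η + bound         ≤⟨ p≤p+q (<⇒≤ 0<η) ⟩
          B * L n + η + bound + η     ≡⟨ regroup (B * L n) ⟩
          B * L n + (bound + ε)       ∎)
        (begin
          B * L n                     ≤⟨ proj₂ (log-between n M₂≤n) ⟩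
          B * hi + η                  ≤⟨ +-monoˡ-≤ η B*hi≤ ⟩
          B * lo + bound + η          ≡⟨ cong (λ y → y + bound + η) (root-sum (λ m → recipℕ (suc m))) ⟨
          V 0 + bound + η             ≤⟨ +-monoˡ-≤ η (+-monoˡ-≤ bound (proj₂ lower-η (suc n) (ℕ.m≤n⇒m≤1+n M₁≤n))) ⟩
          ∑< (suc n) F + η + bound + η ≡⟨ cong (λ y → y + η + bound + η) (∑term≡∑F n) ⟨
          T + η + bound + η           ≡⟨ regroup T ⟩
          T + (bound + ε)             ∎)
        where
        open ≤-Reasoning
        T = ∑< n (term b≥2 w (suc j))
        regroup : ∀ y → y + η + bound + η ≡ y + (bound + ε)
        regroup y = trans (solve 3 (λ y h q → y :+ h :+ q :+ h := y :+ (q :+ (h :+ h))) refl y η bound)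
          (cong (λ e → y + (bound + e)) η+η)

theorem1 : (b : ℕ) (b≥2 : 2 ℕ.≤ b) (p : ℕ) → 1 ℕ.≤ p → (w : Vec (Fin b) p) →
    Σ[ S ∈ (ℕ → ℝ) ] ((k : ℕ) → HasSum (term b≥2 w k) (S k)) ×
    ((k : ℕ) → 1 ℕ.≤ k →
    ∣ S k -ᴿ (fromℕ b ^ p) · log (fromℕ b) (1≤fromℕ b≥2) ∣ᴿ
    ≤ᴿ fromℚ ((fromℕ b - 1ℚ) * fromℕ b ^ℤ (+ p ℤ.- + (k ℕ.⊔ 2) ℤ.+ + 1)))
theorem1 b b≥2 p 1≤p w with Digits.v b b≥2 w in v≡
... | []     = contradiction (trans (sym (cong length v≡)) (Digits.length-v b b≥2 w)) (ℕ.<⇒≢ 1≤p)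
... | x ∷ xs = S , (λ k → Cauchy⇒HasSum (term b≥2 w k) (cauchy (S k))) , λ { (suc j) _ → S-close j }
  where open Word b b≥2 p 1≤p w x xs v≡
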